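{- Let $H$ be a trigraph. If the underlying graph of $H$ has an induced subgraph of girth at least $7$ which is a subdivision of $K_4$, then $\operatorname{tww}(H)\geq 3$.
   Context: A trigraph has vertex set and disjoint black and red edge sets; its underlying graph uses all edges. Contracting distinct $u,v$ gives a new vertex $x$ with $xy$ black if $uy,vy$ both black, absent if neither is an edge, red otherwise; $\operatorname{tww}(H)$ is the least $d$ such that some sequence of contractions down to one vertex keeps every trigraph's maximum red degree at most $d$. A subdivision of $K_4$ is obtained by replacing its edges by internally disjoint paths. -}

module Defs where

open import Data.Nat using (ℕ; zero; suc; _≤_)
open import Data.Fin using (Fin; punchIn) renaming (zero to f0; suc to fs)
open import Data.Fin.Properties using (_≟_)
open import Data.List using (List; []; _∷_; _++_; length; map; allFin; head; last)
open import Data.Nat.ListAction using (sum)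
open import Data.List.Membership.Propositional using (_∈_)
open import Data.List.Relation.Unary.All using (All)
open import Data.List.Relation.Unary.Unique.Propositional using (Unique)
open import Data.Maybe using (just)
open import Data.Product using (Σ; ∃; _×_; _,_)
open import Data.Sum using (_⊎_)
open import Data.Unit using (⊤)
open import Relation.Nullary using (¬_; Dec; yes; no)
open import Relation.Binary.PropositionalEquality using (_≡_; _≢_; refl; sym; cong₂)

-- Trigraphs on vertex set Fin n.  Each (unordered) pair of vertices is
-- either a non-edge, a black edge or a red edge; so black and red edge
-- sets are disjoint by construction.

data Col : Set where
  none black red : Col

record Trigraph (n : ℕ) : Set where
  field
    E      : Fin n → Fin n → Col
    E-sym  : ∀ i j → E i j ≡ E j i
    E-irr  : ∀ i → E i i ≡ none
open Trigraph public

-- colour of xy after contracting u,v into x, given colours of uy and vy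
merge : Col → Col → Col
merge black black = black
merge none  none  = none
merge _     _     = red

merge-comm : ∀ a b → merge a b ≡ merge b a
merge-comm none none = refl
merge-comm none black = refl
merge-comm none red = refl
merge-comm black none = refl
merge-comm black black = refl
merge-comm black red = refl
merge-comm red none = refl
merge-comm red black = refl
merge-comm red red = refl

-- Contraction of two distinct vertices u v of a trigraph on Fin (suc n).
-- The result lives on Fin n: new vertex i stands for old vertex
-- punchIn v i (i.e. v is deleted), and the old vertex u becomes the
-- contracted vertex x.

module Contraction {n : ℕ} (G : Trigraph (suc n)) (u v : Fin (suc n)) where
  private
    F = E G

  cE : (a b : Fin (suc n)) → Dec (a ≡ u) → Dec (b ≡ u) → Col
  cE a b (yes _) _       = merge (F u b) (F v b)
  cE a b (no _) (yes _)  = merge (F a u) (F a v)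
  cE a b (no _) (no _)   = F a b

  cE-sym : ∀ a b da db → cE a b da db ≡ cE b a db da
  cE-sym a b (yes refl) (yes refl) = refl
  cE-sym a b (yes refl) (no _) = cong₂ merge (E-sym G u b) (E-sym G v b)
  cE-sym a b (no _) (yes refl) = cong₂ merge (E-sym G a u) (E-sym G a v)
  cE-sym a b (no _) (no _) = E-sym G a b

  E′ : (i j : Fin n) → Dec (i ≡ j) → Col
  E′ i j (yes _) = none
  E′ i j (no _)  = cE (punchIn v i) (punchIn v j) (punchIn v i ≟ u) (punchIn v j ≟ u)

  E′-sym : ∀ i j → E′ i j (i ≟ j) ≡ E′ j i (j ≟ i)
  E′-sym i j with i ≟ j | j ≟ i
  ... | yes _ | yes _ = refl
  ... | yes p | no q  = Data.Empty.⊥-elim (q (sym p))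
    where import Data.Empty
  ... | no p  | yes q = Data.Empty.⊥-elim (p (sym q))
    where import Data.Empty
  ... | no _  | no _  = cE-sym (punchIn v i) (punchIn v j) (punchIn v i ≟ u) (punchIn v j ≟ u)

  E′-irr : ∀ i → E′ i i (i ≟ i) ≡ none
  E′-irr i with i ≟ i
  ... | yes _ = refl
  ... | no ¬p = Data.Empty.⊥-elim (¬p refl)
    where import Data.Empty

contract : ∀ {n} → Trigraph (suc n) → (u v : Fin (suc n)) → u ≢ v → Trigraph n
contract G u v _ = record
  { E     = λ i j → E′ i j (i ≟ j)
  ; E-sym = E′-sym
  ; E-irr = E′-irr }
  where open Contraction G u v

isRed : Col → ℕ
isRed red = 1
isRed _   = 0

redDeg : ∀ {n} → Trigraph n → Fin n → ℕ
redDeg {n} G i = sum (map (λ j → isRed (E G i j)) (allFin n))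

RedBounded : ∀ {n} → ℕ → Trigraph n → Set
RedBounded d G = ∀ i → redDeg G i ≤ d

data ContrSeq (d : ℕ) : ∀ {n} → Trigraph (suc n) → Set where
  done : (G : Trigraph 1) → RedBounded d G → ContrSeq d G
  step : ∀ {n} (G : Trigraph (suc (suc n))) → RedBounded d G →
         (u v : Fin (suc (suc n))) (u≢v : u ≢ v) →
         ContrSeq d (contract G u v u≢v) → ContrSeq d G

-- tww(G) ≤ d  (the empty trigraph has twin-width 0)
TwwAtMost : ∀ {n} → ℕ → Trigraph n → Set
TwwAtMost {zero}  d G = ⊤
TwwAtMost {suc n} d G = ContrSeq d G

-- k ≤ tww(G), tww being the least d with tww(G) ≤ d
TwwAtLeast : ∀ {n} → ℕ → Trigraph n → Set
TwwAtLeast k G = ∀ d → TwwAtMost d G → k ≤ d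

Adj : ∀ {n} → Trigraph n → Fin n → Fin n → Set
Adj G i j = ¬ (E G i j ≡ none)

Walk : ∀ {n} → (Fin n → Fin n → Set) → List (Fin n) → Set
Walk R []           = ⊤
Walk R (x ∷ [])     = ⊤
Walk R (x ∷ y ∷ xs) = R x y × Walk R (y ∷ xs)

Consecutive : ∀ {n} → Fin n → Fin n → List (Fin n) → Set
Consecutive x y p = ∃ λ as → ∃ λ bs → p ≡ as ++ x ∷ y ∷ bs

k4src k4tgt : Fin 6 → Fin 4
k4src f0                          = f0
k4src (fs f0)                     = f0
k4src (fs (fs f0))                = f0
k4src (fs (fs (fs f0)))           = fs f0
k4src (fs (fs (fs (fs f0))))      = fs f0
k4src (fs (fs (fs (fs (fs f0))))) = fs (fs f0)
k4tgt f0                          = fs f0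
k4tgt (fs f0)                     = fs (fs f0)
k4tgt (fs (fs f0))                = fs (fs (fs f0))
k4tgt (fs (fs (fs f0)))           = fs (fs f0)
k4tgt (fs (fs (fs (fs f0))))      = fs (fs (fs f0))
k4tgt (fs (fs (fs (fs (fs f0))))) = fs (fs (fs f0))

record InducedK4Subdivision {n : ℕ} (R : Fin n → Fin n → Set) : Set where
  field
    b       : Fin 4 → Fin n
    b-inj   : ∀ k l → b k ≡ b l → k ≡ l
    P       : Fin 6 → List (Fin n)
    P-head  : ∀ e → head (P e) ≡ just (b (k4src e))
    P-last  : ∀ e → last (P e) ≡ just (b (k4tgt e))
    P-uniq  : ∀ e → Unique (P e)
    P-walk  : ∀ e → Walk R (P e)
    P-branch : ∀ e k → b k ∈ P e → k ≡ k4src e ⊎ k ≡ k4tgt e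
    P-disj  : ∀ e e′ x → e ≢ e′ → x ∈ P e → x ∈ P e′ → ∃ λ k → x ≡ b k
  InS : Fin n → Set
  InS x = ∃ λ e → x ∈ P e
  field
    induced : ∀ x y → InS x → InS y → R x y →
              ∃ λ e → Consecutive x y (P e) ⊎ Consecutive y x (P e)

IsCycleIn : ∀ {n} → (Fin n → Fin n → Set) → (Fin n → Set) → List (Fin n) → Set
IsCycleIn R S c =
  3 ≤ length c × Unique c × All S c × Walk R c ×
  (∃ λ x → ∃ λ y → head c ≡ just x × last c ≡ just y × R y x)

GirthAtLeast : ∀ {n} {R : Fin n → Fin n → Set} → ℕ → InducedK4Subdivision R → Set
GirthAtLeast {R = R} g K = ∀ c → IsCycleIn R (InducedK4Subdivision.InS K) c → g ≤ length c

{-# OPTIONS --safe #-}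
module Submission where

-- A contraction sequence of H partitions the vertices of the subdivision S into parts.  As
-- long as the red degree is at most 2, the quotient of S by the parts, after discarding
-- some parts, keeps the following shape.  Every part has two or three neighbours, and
-- its arcs carry labels (start, end, rank), recording on which directed path of a
-- K₄-subdivision they lie, so that a closed walk without backtracking makes at least
-- three turns at parts of degree three.  To contract u and v, note that the merged part
-- sees at most two parts, apart from those completely joined to both u and v (black on
-- both sides).  A part with three neighbours has a black edge, hence any two of
-- its vertices have a common neighbour in S.  Together with the absence of cycles of
-- length at most 6 in S this leaves two cases: u and v are adjacent of degree two, so a path
-- is shortened, or they are of degree two with a single common neighbour c.  In the
-- latter case c is dropped if it has degree two, and otherwise the merged part replaces c as
-- branch vertex.  So a part with at least two neighbours survives forever, which is
-- impossible when only one vertex is left.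

open import Defs
open import Data.Bool using (Bool; true; false; not; if_then_else_)
open import Data.Nat using (ℕ; zero; suc; _+_; _≤_; _<_; z≤n; s≤s; _≤?_)
open import Data.Nat.Properties using (≤-refl; ≤-trans; <-trans; <-irrefl; +-monoʳ-≤; +-mono-≤; +-identityʳ; ≰⇒>; ≤-pred; module ≤-Reasoning)
open import Data.Nat.ListAction using (sum)
open import Data.Nat.ListAction.Properties using (sum-↭)
open import Data.Fin using (Fin; punchIn; punchOut) renaming (zero to f0; suc to fs)
open import Data.Fin.Properties using (_≟_; any?; all?; punchIn-punchOut; punchOut-cong; punchIn-injective)
open import Data.List using (List; []; _∷_; _++_; [_]; map; length; reverse; head; last; _∷ʳ_; initLast; _∷ʳ′_)
open import Data.List.Properties using (reverse-++; unfold-reverse; reverse-involutive; ++-assoc; ∷-injective; ∷-injectiveʳ)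
open import Data.List.Membership.Propositional using (_∈_)
open import Data.List.Membership.Propositional.Properties using (∈-∃++; ∈-++⁺ʳ; ∈-allFin)
import Data.List.Membership.DecPropositional as DecMembership
open import Data.List.Relation.Unary.All as All using ([]; _∷_)
open import Data.List.Relation.Unary.Any using (here; there)
open import Data.List.Relation.Unary.Any.Properties using () renaming (reverse⁻ to Any-reverse⁻)
open import Data.List.Relation.Unary.AllPairs using ([]; _∷_)
open import Data.List.Relation.Unary.Unique.Propositional using (Unique)
open import Data.List.Relation.Binary.Subset.Propositional using (_⊆_)
open import Data.List.Relation.Binary.Permutation.Propositional using (_↭_; ↭-sym; ↭⇒↭ₛ)
open import Data.List.Relation.Binary.Permutation.Propositional.Properties using (shift; ∈-resp-↭; map⁺; ↭-reverse)
import Data.List.Relation.Binary.Permutation.Setoid.Properties as SetoidPermutation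
open import Data.Maybe using (Maybe; just; nothing; _>>=_)
open import Data.Maybe.Properties using (just-injective) renaming (≡-dec to maybe-≡-dec)
open import Data.Unit using (⊤; tt)
open import Data.Empty using (⊥; ⊥-elim)
open import Data.Product using (∃; _×_; _,_; proj₁; proj₂)
open import Data.Sum using (_⊎_; inj₁; inj₂; [_,_]′; swap)
open import Relation.Nullary using (¬_; Dec; yes; no; does; contradiction)
open import Relation.Nullary.Decidable using (_×-dec_; _⊎-dec_; _→-dec_; ¬?; from-yes; dec-true; dec-false)
open import Relation.Binary.PropositionalEquality using (_≡_; _≢_; refl; sym; trans; cong; subst; subst₂; ≢-sym; setoid; module ≡-Reasoning)
open import Function using (_∘_)

-- Colours, sums over duplicate-free lists, and red degree at most 2.

_≟ᶜ_ : (a b : Col) → Dec (a ≡ b)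
none ≟ᶜ none = yes refl
none ≟ᶜ black = no λ ()
none ≟ᶜ red = no λ ()
black ≟ᶜ none = no λ ()
black ≟ᶜ black = yes refl
black ≟ᶜ red = no λ ()
red ≟ᶜ none = no λ ()
red ≟ᶜ black = no λ ()
red ≟ᶜ red = yes refl

one-of : ∀ {n} {i j k : Fin n} → (i ≢ j → i ≢ k → ⊥) → i ≡ j ⊎ i ≡ k
one-of {i = i} {j} {k} f with i ≟ j | i ≟ k
... | yes e | _       = inj₁ e
... | no _  | yes e   = inj₂ e
... | no ≢j | no ≢k   = ⊥-elim (f ≢j ≢k)

both-of : ∀ {A : Set} (P : A → Set) {a a′ b b′} → b ≢ b′ → b ≡ a ⊎ b ≡ a′ → b′ ≡ a ⊎ b′ ≡ a′ →
  P b → P b′ → P a × P a′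
both-of P b≢b′ (inj₁ refl) (inj₁ refl) _ _ = contradiction refl b≢b′
both-of P b≢b′ (inj₂ refl) (inj₂ refl) _ _ = contradiction refl b≢b′
both-of P b≢b′ (inj₁ refl) (inj₂ refl) pb pb′ = pb , pb′
both-of P b≢b′ (inj₂ refl) (inj₁ refl) pb pb′ = pb′ , pb

sum-map-⊆ : ∀ {A : Set} (f : A → ℕ) {xs ys} → Unique xs → xs ⊆ ys → sum (map f xs) ≤ sum (map f ys)
sum-map-⊆ f [] _ = z≤n
sum-map-⊆ f {x ∷ xs} {ys} (x∉ ∷ u) sub with ∈-∃++ (sub (here refl))
... | as , bs , refl = begin
  f x + sum (map f xs)          ≤⟨ +-monoʳ-≤ (f x) (sum-map-⊆ f u sub′) ⟩
  f x + sum (map f (as ++ bs))  ≡⟨ sum-↭ (map⁺ f perm) ⟨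
  sum (map f (as ++ x ∷ bs))    ∎
  where
  open ≤-Reasoning
  perm : as ++ x ∷ bs ↭ x ∷ as ++ bs
  perm = shift x as bs
  sub′ : xs ⊆ as ++ bs
  sub′ y∈ with ∈-resp-↭ perm (sub (there y∈))
  ... | here refl = ⊥-elim (All.lookup x∉ y∈ refl)
  ... | there y∈′ = y∈′

-- The three red neighbours form a duplicate-free sublist of `allFin`, so they alone contribute 3 to
-- `redDeg G i`.
no-three-red : ∀ {n} {G : Trigraph n} → RedBounded 2 G → ∀ {i j k l} → j ≢ k → j ≢ l → k ≢ l →
  E G i j ≡ red → E G i k ≡ red → E G i l ≡ red → ⊥
no-three-red {G = G} bounded {i} {j} {k} {l} j≢k j≢l k≢l ej ek el = contradiction three≤two λ { (s≤s (s≤s ())) }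
  where
  f = λ x → isRed (E G i x)
  three : sum (map f (j ∷ k ∷ l ∷ [])) ≡ 3
  three rewrite ej | ek | el = refl
  three≤two : 3 ≤ 2
  three≤two = ≤-trans
    (subst (_≤ redDeg G i) three
      (sum-map-⊆ f ((j≢k ∷ j≢l ∷ []) ∷ (k≢l ∷ []) ∷ [] ∷ []) (λ {x} _ → ∈-allFin x)))
    (bounded i)

some-black : ∀ {n} {G : Trigraph n} → RedBounded 2 G → ∀ {i j k l} → j ≢ k → j ≢ l → k ≢ l →
  E G i j ≢ none → E G i k ≢ none → E G i l ≢ none →
  E G i j ≡ black ⊎ E G i k ≡ black ⊎ E G i l ≡ black
some-black {G = G} bounded {i} {j} {k} {l} j≢k j≢l k≢l nj nk nl
  with E G i j in ej | E G i k in ek | E G i l in el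
... | none  | _     | _     = contradiction refl nj
... | _     | none  | _     = contradiction refl nk
... | _     | _     | none  = contradiction refl nl
... | black | _     | _     = inj₁ refl
... | red   | black | _     = inj₂ (inj₁ refl)
... | red   | red   | black = inj₂ (inj₂ refl)
... | red   | red   | red   = ⊥-elim (no-three-red {G = G} bounded j≢k j≢l k≢l ej ek el)

-- Every mixed pair merges to red, so a black edge or a non-edge of a contraction is uniform over
-- the vertices merged.
merge-pure : ∀ {c} a b → c ≢ red → merge a b ≡ c → a ≡ c × b ≡ c
merge-pure none none _ refl = refl , refl
merge-pure black black _ refl = refl , refl
merge-pure none black c≢ refl = contradiction refl c≢
merge-pure none red c≢ refl = contradiction refl c≢
merge-pure black none c≢ refl = contradiction refl c≢
merge-pure black red c≢ refl = contradiction refl c≢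
merge-pure red none c≢ refl = contradiction refl c≢
merge-pure red black c≢ refl = contradiction refl c≢
merge-pure red red c≢ refl = contradiction refl c≢

-- The quotient map of a contraction and the colours it preserves.

module Quotient {m} (u v : Fin (suc m)) (u≢v : u ≢ v) where

  -- The inverse of `punchIn v`, extended to `v` by the image of `u`.
  q : Fin (suc m) → Fin m
  q j with v ≟ j
  ... | yes _   = punchOut (≢-sym u≢v)
  ... | no v≢j  = punchOut v≢j

  Rep : Fin (suc m) → Fin (suc m) → Set
  Rep j a = a ≡ j ⊎ j ≡ v × a ≡ u

  rep : ∀ j → Rep j (punchIn v (q j))
  rep j with v ≟ j
  ... | yes refl = inj₂ (refl , punchIn-punchOut (≢-sym u≢v))
  ... | no v≢j   = inj₁ (punchIn-punchOut v≢j)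

  q-merges : q v ≡ q u
  q-merges with v ≟ v | v ≟ u
  ... | no v≢v | _ = contradiction refl v≢v
  ... | yes _  | yes v≡u = contradiction (sym v≡u) u≢v
  ... | yes _  | no _ = punchOut-cong v refl

  data Same : Fin (suc m) → Fin (suc m) → Set where
    equal : ∀ {j} → Same j j
    uv    : Same u v
    vu    : Same v u

  q-reflects : ∀ {j k} → q j ≡ q k → Same j k
  q-reflects {j} {k} eq with punchIn v (q j) | punchIn v (q k) | cong (punchIn v) eq | rep j | rep k
  ... | _ | _ | refl | inj₁ refl | inj₁ refl = equal
  ... | _ | _ | refl | inj₁ refl | inj₂ (refl , refl) = uv
  ... | _ | _ | refl | inj₂ (refl , refl) | inj₁ refl = vu
  ... | _ | _ | refl | inj₂ (refl , refl) | inj₂ (refl , _) = equal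

  q-inj : ∀ {j k} → q j ≡ q k → j ≢ u → j ≢ v → j ≡ k
  q-inj eq j≢u j≢v with q-reflects eq
  ... | equal = refl
  ... | uv = contradiction refl j≢u
  ... | vu = contradiction refl j≢v

  module _ (G : Trigraph (suc m)) where
    open Contraction G u v

    cE-pure : ∀ {I J a b c} → Rep I a → Rep J b → a ≢ b → c ≢ red →
      ∀ da db → cE a b da db ≡ c → E G I J ≡ c
    cE-pure (inj₁ refl) (inj₁ refl) a≢b c≢ (yes refl) _ eq = proj₁ (merge-pure _ _ c≢ eq)
    cE-pure (inj₁ refl) (inj₂ (refl , refl)) a≢b c≢ (yes refl) _ eq = contradiction refl a≢b
    cE-pure (inj₂ (refl , refl)) (inj₁ refl) a≢b c≢ (yes _) _ eq = proj₂ (merge-pure _ _ c≢ eq)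
    cE-pure (inj₂ (refl , refl)) (inj₂ (refl , refl)) a≢b c≢ (yes _) _ eq = contradiction refl a≢b
    cE-pure (inj₁ refl) (inj₁ refl) a≢b c≢ (no _) (yes refl) eq = proj₁ (merge-pure _ _ c≢ eq)
    cE-pure (inj₁ refl) (inj₂ (refl , refl)) a≢b c≢ (no _) (yes _) eq = proj₂ (merge-pure _ _ c≢ eq)
    cE-pure (inj₂ (_ , refl)) _ a≢b c≢ (no u≢u) _ eq = contradiction refl u≢u
    cE-pure (inj₁ refl) (inj₁ refl) a≢b c≢ (no _) (no _) eq = eq
    cE-pure (inj₁ refl) (inj₂ (_ , refl)) a≢b c≢ (no _) (no u≢u) eq = contradiction refl u≢u

    -- Serves twice: with `none` it shows that arcs still lie over edges of the contraction, with
    -- `black` that black edges still join two parts completely.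
    contract-pure : ∀ {I J c} → q I ≢ q J → c ≢ red → E (contract G u v u≢v) (q I) (q J) ≡ c → E G I J ≡ c
    contract-pure {I} {J} qI≢qJ c≢ eq with q I ≟ q J
    ... | yes qI≡qJ = contradiction qI≡qJ qI≢qJ
    ... | no _ = cE-pure (rep I) (rep J) (qI≢qJ ∘ punchIn-injective v _ _) c≢ (punchIn v (q I) ≟ u) (punchIn v (q J) ≟ u) eq

    -- By `contract-pure`, a black edge here would be black from both `u` and `v`, and a non-edge
    -- would be absent from both.
    contract-red : ∀ {k} → k ≢ u → k ≢ v → ¬ (E G u k ≡ black × E G v k ≡ black) →
      E G u k ≢ none ⊎ E G v k ≢ none → E (contract G u v u≢v) (q u) (q k) ≡ red
    contract-red {k} k≢u k≢v ¬black seen = red! _ refl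
      where
      G′ = contract G u v u≢v
      qu≢qk : q u ≢ q k
      qu≢qk eq = k≢u (q-inj (sym eq) k≢u k≢v)
      both : ∀ {c} → c ≢ red → E G′ (q u) (q k) ≡ c → E G u k ≡ c × E G v k ≡ c
      both c≢ eq = contract-pure qu≢qk c≢ eq ,
        contract-pure (subst (_≢ q k) (sym q-merges) qu≢qk) c≢ (subst (λ i → E G′ i (q k) ≡ _) (sym q-merges) eq)
      red! : ∀ c → E G′ (q u) (q k) ≡ c → E G′ (q u) (q k) ≡ red
      red! red eq = eq
      red! black eq = contradiction (both (λ ()) eq) ¬black
      red! none eq = ⊥-elim ([ (λ n → n (proj₁ (both (λ ()) eq))) , (λ n → n (proj₂ (both (λ ()) eq))) ]′ seen)

-- Labels of arcs and their behaviour under turns.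

record Lab : Set where
  constructor mkLab
  field
    tl hd : Fin 4
    rk    : ℕ
open Lab

-- What n turns at vertices of degree three do to a label: the walk stays on a path of
-- the K₄-subdivision (n = 0), enters the next one (n = 1), or has left its first
-- branch vertex for a different one (n = 2).
Go : ℕ → Lab → Lab → Set
Go 0 l l′ = tl l′ ≡ tl l × hd l′ ≡ hd l × rk l′ < rk l
Go 1 l l′ = tl l′ ≡ hd l × hd l′ ≢ tl l
Go 2 l l′ = tl l′ ≢ tl l
Go (suc (suc (suc _))) _ _ = ⊤

Go-trans : ∀ m n {l l′ l″} → Go m l l′ → Go n l′ l″ → Go (m + n) l l″
Go-trans 0 0 (t , h , r) (t′ , h′ , r′) = trans t′ t , trans h′ h , <-trans r′ r
Go-trans 0 1 (t , h , _) (t′ , h′) = trans t′ h , λ e → h′ (trans e (sym t))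
Go-trans 0 2 (t , _ , _) t′ = λ e → t′ (trans e (sym t))
Go-trans 0 (suc (suc (suc _))) _ _ = tt
Go-trans 1 0 (t , h) (t′ , h′ , _) = trans t′ t , λ e → h (trans (sym h′) e)
Go-trans 1 1 (t , h) (t′ , _) = λ e → h (trans (sym t′) e)
Go-trans 1 (suc (suc _)) _ _ = tt
Go-trans 2 0 t (t′ , _ , _) = λ e → t (trans (sym t′) e)
Go-trans 2 (suc _) _ _ = tt
Go-trans (suc (suc (suc _))) _ _ _ = tt

-- With no turn the rank would drop, with one the tail would become the head, with two the tail
-- would change. A closed walk returns to its first label, so it makes at least three turns.
Go-irrefl : ∀ {n l} → tl l ≢ hd l → n ≤ 2 → Go n l l → ⊥
Go-irrefl _ z≤n (_ , _ , r) = <-irrefl refl r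
Go-irrefl t≢h (s≤s z≤n) (t , _) = t≢h t
Go-irrefl _ (s≤s (s≤s z≤n)) t = t refl

-- Applied to every label that a contraction does not rewrite. Rank 0 thereby becomes free for a new
-- last arc of a path, which is used when a branch vertex moves.
bump : Lab → Lab
bump l = mkLab (tl l) (hd l) (suc (rk l))

Go-bump : ∀ n {l l′} → Go n l l′ → Go n (bump l) (bump l′)
Go-bump 0 (t , h , r) = t , h , s≤s r
Go-bump 1 g = g
Go-bump 2 g = g
Go-bump (suc (suc (suc _))) _ = tt

-- Graphs of girth at least 7, their quotients, and the invariant.

record LargeGirth (N : ℕ) : Set₁ where
  field
    _~_   : Fin N → Fin N → Set
    ~-sym : ∀ {x y} → x ~ y → y ~ x
    no3 : ∀ {a b c} → a ~ b → b ~ c → c ~ a → ⊥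
    no4 : ∀ {a b c d} → a ~ b → b ~ c → c ~ d → d ~ a → a ≢ c → b ≢ d → ⊥
    -- no distinctness is needed here: backtracking leaves a triangle
    no5 : ∀ {a b c d e} → a ~ b → b ~ c → c ~ d → d ~ e → e ~ a → ⊥
    no6 : ∀ {a b c d e f} → a ~ b → b ~ c → c ~ d → d ~ e → e ~ f → f ~ a →
          a ≢ c → b ≢ d → c ≢ e → d ≢ f → e ≢ a → f ≢ b → ⊥

module Graph {N : ℕ} (Γ : LargeGirth N) where
  open LargeGirth Γ

  -- The closed walk `c z t y t′ w` is a cycle of length 6, or leaves one of length 4 when `t`
  -- equals `t′` or `y` equals `z` or `w`.
  no-hub : ∀ {c z w t t′ y} → c ~ z → c ~ w → z ~ t → w ~ t′ → y ~ t → y ~ t′ →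
    c ≢ t → c ≢ t′ → z ≢ w → ⊥
  no-hub {c} {z} {w} {t} {t′} {y} cz cw zt wt′ yt yt′ c≢t c≢t′ z≢w
    with t ≟ t′ | y ≟ z | y ≟ w
  ... | yes refl | _ | _ = no4 cz zt (~-sym wt′) (~-sym cw) c≢t z≢w
  ... | no _ | yes refl | _ = no4 cz yt′ (~-sym wt′) (~-sym cw) c≢t′ z≢w
  ... | no _ | no _ | yes refl = no4 cz zt (~-sym yt) (~-sym cw) c≢t z≢w
  ... | no t≢t′ | no y≢z | no y≢w =
    no6 cz zt (~-sym yt) yt′ (~-sym wt′) (~-sym cw) c≢t (≢-sym y≢z) t≢t′ y≢w (≢-sym c≢t′) (≢-sym z≢w)

  -- `π` is `nothing` on vertices outside the subdivision or in discarded parts. Labels sit on pairs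
  -- of vertices rather than of parts, so that renumbering the parts does not affect them.
  module Parts {m : ℕ} (π : Fin N → Maybe (Fin m)) (lab : Fin N → Fin N → Lab) where

    record Arc (I J : Fin m) : Set where
      constructor arc
      field
        {x y} : Fin N
        x∈    : π x ≡ just I
        y∈    : π y ≡ just J
        adj   : x ~ y
        ends≢ : I ≢ J
    open Arc public

    ℓ : ∀ {I J} → Arc I J → Lab
    ℓ α = lab (x α) (y α)

    rev : ∀ {I J} → Arc I J → Arc J I
    rev (arc a b e n) = arc b a (~-sym e) (≢-sym n)

    elem≢ : ∀ {I J a b} → I ≢ J → π a ≡ just I → π b ≡ just J → a ≢ b
    elem≢ I≢J ea eb refl = I≢J (just-injective (trans (sym ea) eb))

    -- The number of turns charged to a walk that passes through `J` into another part than it came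
    -- from. The vertices of entry and of exit may differ.
    Turns : ℕ → Fin m → Set
    Turns n J = ∀ {I K} → I ≢ K → (α : Arc I J) (β : Arc J K) → Go n (ℓ α) (ℓ β)

    record Two (J : Fin m) : Set where
      constructor two
      field
        p q  : Fin m
        p≢q  : p ≢ q
        →p   : Arc J p
        →q   : Arc J q
        only : ∀ {K} → Arc J K → K ≡ p ⊎ K ≡ q
        turn : Turns 0 J

    record Three (J : Fin m) : Set where
      constructor three
      field
        p q r : Fin m
        p≢q   : p ≢ q
        p≢r   : p ≢ r
        q≢r   : q ≢ r
        →p    : Arc J p
        →q    : Arc J q
        →r    : Arc J r
        only  : ∀ {K} → Arc J K → K ≡ p ⊎ K ≡ q ⊎ K ≡ r
        turn  : Turns 1 J

    Node : Fin m → Set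
    Node J = Two J ⊎ Three J

    swap2 : ∀ {J} → Two J → Two J
    swap2 (two p q p≢q →p →q only turn) = two q p (≢-sym p≢q) →q →p (swap ∘ only) turn

    swap3 : ∀ {J} → Three J → Three J
    swap3 (three p q r p≢q p≢r q≢r →p →q →r only turn) =
      three q p r (≢-sym p≢q) q≢r p≢r →q →p →r
        (λ α → [ (λ e → inj₂ (inj₁ e)) , [ inj₁ , (λ e → inj₂ (inj₂ e)) ]′ ]′ (only α)) turn

    rot3 : ∀ {J} → Three J → Three J
    rot3 (three p q r p≢q p≢r q≢r →p →q →r only turn) =
      three r p q (≢-sym p≢r) (≢-sym q≢r) p≢q →r →p →q
        (λ α → [ (λ e → inj₂ (inj₁ e)) , [ (λ e → inj₂ (inj₂ e)) , inj₁ ]′ ]′ (only α)) turn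

    front2 : ∀ {J K} → Two J → Arc J K → ∃ λ (T : Two J) → Two.p T ≡ K
    front2 T α with Two.only T α
    ... | inj₁ e = T , sym e
    ... | inj₂ e = swap2 T , sym e

    front3 : ∀ {J K} → Three J → Arc J K → ∃ λ (T : Three J) → Three.p T ≡ K
    front3 T α with Three.only T α
    ... | inj₁ e = T , sym e
    ... | inj₂ (inj₁ e) = swap3 T , sym e
    ... | inj₂ (inj₂ e) = rot3 T , sym e

    arc? : ∀ {J} → Node J → ∀ K → Dec (Arc J K)
    arc? (inj₁ (two p q _ →p →q only _)) K with K ≟ p | K ≟ q
    ... | yes refl | _ = yes →p
    ... | no _ | yes refl = yes →q
    ... | no K≢p | no K≢q = no λ α → [ K≢p , K≢q ]′ (only α)
    arc? (inj₂ (three p q r _ _ _ →p →q →r only _)) K with K ≟ p | K ≟ q | K ≟ r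
    ... | yes refl | _ | _ = yes →p
    ... | no _ | yes refl | _ = yes →q
    ... | no _ | no _ | yes refl = yes →r
    ... | no K≢p | no K≢q | no K≢r = no λ α → [ K≢p , [ K≢q , K≢r ]′ ]′ (only α)

    deg : ∀ {J} → Node J → ℕ
    deg (inj₁ _) = 0
    deg (inj₂ _) = 1

    deg≤1 : ∀ {J} (ν : Node J) → deg ν ≤ 1
    deg≤1 (inj₁ _) = z≤n
    deg≤1 (inj₂ _) = s≤s z≤n

    turns : ∀ {J} (ν : Node J) → Turns (deg ν) J
    turns (inj₁ T) = Two.turn T
    turns (inj₂ T) = Three.turn T

    alive? : ∀ J → Dec (∃ λ x → π x ≡ just J)
    alive? J = any? λ x → maybe-≡-dec _≟_ (π x) (just J)

  -- `cons` makes a label depend on the two parts only, and `some` keeps the invariant from holding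
  -- emptily when a single vertex is left.
  record State {m} (G : Trigraph m) : Set where
    field
      π   : Fin N → Maybe (Fin m)
      lab : Fin N → Fin N → Lab
    open Parts π lab public
    field
      tl≢hd : ∀ x y → tl (lab x y) ≢ hd (lab x y)
      cons  : ∀ {I J} (α β : Arc I J) → ℓ α ≡ ℓ β
      seen  : ∀ {I J} → Arc I J → E G I J ≢ none
      full  : ∀ {x y I J} → π x ≡ just I → π y ≡ just J → E G I J ≡ black → x ~ y
      node  : ∀ {x J} → π x ≡ just J → Node J
      some  : ∃ λ x → ∃ λ J → π x ≡ just J

    -- Going round once and repeating the first arc gives `Go n` from a label to itself, where `n`
    -- counts the degree-three parts among `J` and `K`.
    no-triangle : ∀ {I J K} → Two I → Arc I J → Arc J K → Arc K I → ⊥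
    no-triangle {I} {J} {K} T α β γ =
      Go-irrefl (tl≢hd _ _) (+-mono-≤ (deg≤1 νJ) (deg≤1 νK))
        (Go-trans (deg νJ) (deg νK) (turns νJ (≢-sym (ends≢ γ)) α β)
          (subst (λ n → Go n _ _) (+-identityʳ (deg νK))
            (Go-trans (deg νK) 0 (turns νK (≢-sym (ends≢ α)) β γ) (Two.turn T (≢-sym (ends≢ β)) γ α))))
      where
      νJ = node (y∈ α)
      νK = node (y∈ β)

    no-square : ∀ {I J K L} (νI : Node I) (νJ : Node J) (νK : Node K) (νL : Node L) →
      deg νI + (deg νJ + (deg νK + deg νL)) ≤ 2 →
      Arc I J → Arc J K → Arc K L → Arc L I → I ≢ K → J ≢ L → ⊥
    no-square νI νJ νK νL small α β γ δ I≢K J≢L =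
      Go-irrefl (tl≢hd _ _) small
        (Go-trans (deg νI) _ (turns νI (≢-sym J≢L) δ α)
        (Go-trans (deg νJ) _ (turns νJ I≢K α β)
        (Go-trans (deg νK) _ (turns νK J≢L β γ) (turns νL (≢-sym I≢K) γ δ))))

  -- Which pairs of parts can be contracted.

  module Pair {m} {G : Trigraph m} (s : State G) (bounded : RedBounded 2 G) where
    open State s

    Common : (u v k : Fin m) → Set
    Common u v k = E G u k ≡ black × E G v k ≡ black

    -- Red degree at most 2 leaves a black edge to one of the three neighbours; any vertex of that
    -- neighbour is adjacent to all of `J`.
    hub : ∀ {J} → Three J → ∃ λ y → ∀ {x} → π x ≡ just J → y ~ x
    hub (three p q r p≢q p≢r q≢r →p →q →r _ _)
      with some-black {G = G} bounded p≢q p≢r q≢r (seen →p) (seen →q) (seen →r)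
    ... | inj₁ e = y →p , λ x∈J → ~-sym (full x∈J (y∈ →p) e)
    ... | inj₂ (inj₁ e) = y →q , λ x∈J → ~-sym (full x∈J (y∈ →q) e)
    ... | inj₂ (inj₂ e) = y →r , λ x∈J → ~-sym (full x∈J (y∈ →r) e)

    -- A vertex of `u` and one of `v`, both with a neighbour in `a`, are connected through `c` on
    -- one side and through the hub of `a` on the other: a closed walk of length 6.
    black-square : ∀ {u v c a} → u ≢ v → Common u v c → Arc u c → Arc u a → Arc v a → c ≢ a → Three a → ⊥
    black-square u≢v (uc , vc) u→c u→a v→a c≢a T with hub T
    ... | h , h~ = no-hub (~-sym (full (x∈ u→a) (y∈ u→c) uc)) (~-sym (full (x∈ v→a) (y∈ u→c) vc))
      (adj u→a) (adj v→a) (h~ (y∈ u→a)) (h~ (y∈ v→a))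
      (elem≢ c≢a (y∈ u→c) (y∈ u→a)) (elem≢ c≢a (y∈ u→c) (y∈ v→a)) (elem≢ u≢v (x∈ u→a) (x∈ v→a))

    -- The black edge and the hub of `K` close the two arcs to a walk of length 5.
    black-triangle : ∀ {I J K} → E G I J ≡ black → Arc I K → Arc J K → Three K → ⊥
    black-triangle IJ α β T with hub T
    ... | h , h~ = no5 (adj α) (~-sym (h~ (y∈ α))) (h~ (y∈ β)) (~-sym (adj β))
      (~-sym (full (x∈ α) (x∈ β) IJ))

    -- Such a `k` becomes a red neighbour of the merged part, whence the bound `AtMostTwo`.
    record Nb (u v k : Fin m) : Set where
      constructor nb
      field
        k≢u     : k ≢ u
        k≢v     : k ≢ v
        joined  : Arc u k ⊎ Arc v k
        ¬common : ¬ Common u v k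

    AtMostTwo : Fin m → Fin m → Set
    AtMostTwo u v = ∀ {i j k} → i ≢ j → i ≢ k → j ≢ k → Nb u v i → Nb u v j → Nb u v k → ⊥

    swap-bound : ∀ {u v} → AtMostTwo u v → AtMostTwo v u
    swap-bound f d d′ d″ a b c = f d d′ d″ (flip a) (flip b) (flip c)
      where
      flip : ∀ {u v k} → Nb v u k → Nb u v k
      flip (nb a b j n) = nb b a (swap j) (λ { (x , y) → n (y , x) })

    data Outcome (u v : Fin m) : Set where
      slide : (U : Two u) (V : Two v) → Two.p U ≡ v → Two.p V ≡ u → Two.q U ≢ Two.q V → Outcome u v
      fold  : (U : Two u) (V : Two v) → Two.p U ≡ Two.p V → Two.q U ≢ Two.q V →
              ¬ Arc u v → Outcome u v

    module Black {u v c} (u≢v : u ≢ v) (bound : AtMostTwo u v) (cb : Common u v c)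
                 (u→c : Arc u c) (v→c : Arc v c) where

      not-adjacent : ¬ Arc u v
      not-adjacent α = no3 (adj α) (full (y∈ α) (y∈ u→c) (proj₂ cb)) (~-sym (full (x∈ α) (y∈ u→c) (proj₁ cb)))

      -- A second common black neighbour would close a 4-cycle with `c`. So every neighbour of `u`
      -- or `v` other than `c` counts towards the bound.
      one-common : ∀ {k x} → π x ≡ just k → c ≢ k → ¬ Common u v k
      one-common x∈k c≢k (uk , vk) = no4
        (full (x∈ u→c) (y∈ u→c) (proj₁ cb)) (~-sym (full (x∈ v→c) (y∈ u→c) (proj₂ cb)))
        (full (x∈ v→c) x∈k vk) (~-sym (full (x∈ u→c) x∈k uk))
        (elem≢ u≢v (x∈ u→c) (x∈ v→c)) (elem≢ c≢k (y∈ u→c) x∈k)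

      nbU : ∀ {k} → Arc u k → c ≢ k → Nb u v k
      nbU α c≢k = nb (≢-sym (ends≢ α)) (λ { refl → not-adjacent α }) (inj₁ α) (one-common (y∈ α) c≢k)

      nbV : ∀ {k} → Arc v k → c ≢ k → Nb u v k
      nbV α c≢k = nb (λ { refl → not-adjacent (rev α) }) (≢-sym (ends≢ α)) (inj₂ α) (one-common (y∈ α) c≢k)

      -- The parts `u`, `Two.q U`, `v`, `c` form a square. If `Two.q U` has degree three, its hub
      -- gives a short cycle; otherwise only `v` and possibly `c` cause a turn.
      shared : (U : Two u) → Three v → Arc v (Two.q U) → Two.p U ≡ c → ⊥
      shared U V v→a refl with node (y∈ (Two.→q U))
      ... | inj₂ T = black-square u≢v cb u→c (Two.→q U) v→a (Two.p≢q U) T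
      ... | inj₁ T = no-square (inj₁ U) (inj₁ T) (inj₂ V) νc (s≤s (deg≤1 νc))
                       (Two.→q U) (rev v→a) v→c (rev u→c) u≢v (≢-sym (Two.p≢q U))
        where νc = node (y∈ u→c)

      not-two-three : Two u → Three v → ⊥
      not-two-three U₀ V₀ with front2 U₀ u→c | front3 V₀ v→c
      ... | U , refl | V , refl with Two.q U ≟ Three.q V | Two.q U ≟ Three.r V
      ... | no ≢q | no ≢r = bound ≢q ≢r (Three.q≢r V) (nbU (Two.→q U) (Two.p≢q U))
                              (nbV (Three.→q V) (Three.p≢q V)) (nbV (Three.→r V) (Three.p≢r V))
      ... | yes refl | _ = shared U V (Three.→q V) refl
      ... | no _ | yes refl = shared U V (Three.→r V) refl

      -- Apart from `c`, each of `u` and `v` has two neighbours, and the bound makes them the same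
      -- two. If one has degree three, `black-square` applies; otherwise the square they form with
      -- `u` and `v` has only two turns.
      not-three-three : Three u → Three v → ⊥
      not-three-three U₀ V₀ with front3 U₀ u→c | front3 V₀ v→c
      ... | U@(three _ a a′ c≢a c≢a′ a≢a′ _ →a →a′ _ _) , refl
          | V@(three _ b b′ c≢b c≢b′ b≢b′ _ →b →b′ _ _) , refl =
        both (both-of (Arc v) b≢b′ (pick →b c≢b) (pick →b′ c≢b′) →b →b′)
        where
        pick : ∀ {k} → Arc v k → c ≢ k → k ≡ a ⊎ k ≡ a′
        pick v→k c≢k = one-of λ k≢a k≢a′ →
          bound a≢a′ (≢-sym k≢a) (≢-sym k≢a′) (nbU →a c≢a) (nbU →a′ c≢a′) (nbV v→k c≢k)
        both : Arc v a × Arc v a′ → ⊥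
        both (v→a , v→a′) with node (y∈ →a) | node (y∈ →a′)
        ... | inj₂ T | _ = black-square u≢v cb u→c →a v→a c≢a T
        ... | inj₁ _ | inj₂ T = black-square u≢v cb u→c →a′ v→a′ c≢a′ T
        ... | inj₁ T | inj₁ T′ = no-square (inj₂ U) (inj₁ T) (inj₂ V) (inj₁ T′) (s≤s (s≤s z≤n))
                                   →a (rev v→a) v→a′ (rev →a′) u≢v a≢a′

      two-two : Two u → Two v → Outcome u v
      two-two U₀ V₀ with front2 U₀ u→c | front2 V₀ v→c
      ... | U , refl | V , pV = fold U V (sym pV) distinct not-adjacent
        where
        νc = node (y∈ u→c)
        distinct : Two.q U ≢ Two.q V
        distinct e = no-square (inj₁ U) νa (inj₁ V) νc (+-mono-≤ (deg≤1 νa) (deg≤1 νc))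
          (Two.→q U) (rev (subst (Arc v) (sym e) (Two.→q V))) v→c (rev u→c) u≢v (≢-sym (Two.p≢q U))
          where νa = node (y∈ (Two.→q U))

    module Plain {u v} (u≢v : u ≢ v) (bound : AtMostTwo u v)
                 (none-common : ∀ {k x} → π x ≡ just k → ¬ Common u v k) where

      nbU : ∀ {k} → k ≢ v → Arc u k → Nb u v k
      nbU k≢v α = nb (≢-sym (ends≢ α)) k≢v (inj₁ α) (none-common (y∈ α))

      nbV : ∀ {k} → k ≢ u → Arc v k → Nb u v k
      nbV k≢u α = nb k≢u (≢-sym (ends≢ α)) (inj₂ α) (none-common (y∈ α))

      nonadjacent : ¬ Arc u v → Three v → ⊥
      nonadjacent ¬uv V = bound (Three.p≢q V) (Three.p≢r V) (Three.q≢r V)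
        (nbV′ (Three.→p V)) (nbV′ (Three.→q V)) (nbV′ (Three.→r V))
        where
        nbV′ : ∀ {k} → Arc v k → Nb u v k
        nbV′ α = nbV (λ { refl → ¬uv (rev α) }) α

      -- By `nonadjacent` the parts are adjacent. Either their other neighbours are three, which
      -- breaks the bound, or one is shared and closes a triangle with `u`, which has degree two.
      not-two-three : Two u → Three v → ⊥
      not-two-three U₀ V₀ with arc? (inj₁ U₀) v
      ... | no ¬uv = nonadjacent ¬uv V₀
      ... | yes u→v with front2 U₀ u→v | front3 V₀ (rev u→v)
      ... | two _ a v≢a _ →a _ _ , refl | three _ b b′ u≢b u≢b′ b≢b′ _ →b →b′ _ _ , refl
          with a ≟ b | a ≟ b′
      ... | yes refl | _ = no-triangle U₀ u→v →b (rev →a)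
      ... | no _ | yes refl = no-triangle U₀ u→v →b′ (rev →a)
      ... | no a≢b | no a≢b′ = bound a≢b a≢b′ b≢b′
              (nbU (≢-sym v≢a) →a) (nbV (≢-sym u≢b) →b) (nbV (≢-sym u≢b′) →b′)

      not-three-three : Three u → Three v → ⊥
      not-three-three U₀ V₀ with arc? (inj₂ U₀) v
      ... | no ¬uv = nonadjacent ¬uv V₀
      ... | yes u→v with front3 U₀ u→v | front3 V₀ (rev u→v)
      ... | three _ a a′ v≢a v≢a′ a≢a′ _ →a →a′ _ _ , refl
          | three _ b b′ u≢b u≢b′ b≢b′ _ →b →b′ _ _ , refl =
        both (both-of (Arc v) b≢b′ (pick →b u≢b) (pick →b′ u≢b′) →b →b′)
        where
        pick : ∀ {k} → Arc v k → u ≢ k → k ≡ a ⊎ k ≡ a′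
        pick v→k u≢k = one-of λ k≢a k≢a′ →
          bound a≢a′ (≢-sym k≢a) (≢-sym k≢a′) (nbU (≢-sym v≢a) →a) (nbU (≢-sym v≢a′) →a′) (nbV (≢-sym u≢k) v→k)
        both : Arc v a × Arc v a′ → ⊥
        both (v→a , v→a′) with node (y∈ →a) | node (y∈ →a′)
        ... | inj₁ T | _ = no-triangle T (rev →a) u→v v→a
        ... | inj₂ _ | inj₁ T = no-triangle T (rev →a′) u→v v→a′
        -- All of `u`, `v`, `a`, `a′` have degree three, so turns do not exclude the triangles. A
        -- black edge at `u` does, through the hub of `a` or of `v`.
        ... | inj₂ T | inj₂ _
          with some-black {G = G} bounded v≢a v≢a′ a≢a′ (seen u→v) (seen →a) (seen →a′)
        ... | inj₁ e = black-triangle e →a v→a T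
        ... | inj₂ (inj₁ e) = black-triangle e u→v (rev v→a) V₀
        ... | inj₂ (inj₂ e) = black-triangle e u→v (rev v→a′) V₀

      -- Non-adjacent `u` and `v` would have the same two neighbours by the bound, and the resulting
      -- square has at most two turns. So only `slide` remains.
      two-two : Two u → Two v → Outcome u v
      two-two U₀ V₀ with arc? (inj₁ U₀) v
      ... | yes u→v with front2 U₀ u→v | front2 V₀ (rev u→v)
      ... | U , refl | V , pV = slide U V refl pV λ e →
            no-triangle U u→v (subst (Arc v) (sym e) (Two.→q V)) (rev (Two.→q U))
      two-two U₀@(two a a′ a≢a′ →a →a′ _ _) V₀@(two b b′ b≢b′ →b →b′ _ _) | no ¬uv =
        ⊥-elim (both (both-of (Arc v) b≢b′ (pick →b) (pick →b′) →b →b′))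
        where
        nbU′ : ∀ {k} → Arc u k → Nb u v k
        nbU′ α = nbU (λ { refl → ¬uv α }) α
        pick : ∀ {k} → Arc v k → k ≡ a ⊎ k ≡ a′
        pick v→k = one-of λ k≢a k≢a′ →
          bound a≢a′ (≢-sym k≢a) (≢-sym k≢a′) (nbU′ →a) (nbU′ →a′) (nbV (λ { refl → ¬uv (rev v→k) }) v→k)
        both : Arc v a × Arc v a′ → ⊥
        both (v→a , v→a′) = no-square (inj₁ U₀) ν (inj₁ V₀) ν′ (+-mono-≤ (deg≤1 ν) (deg≤1 ν′))
          →a (rev v→a) v→a′ (rev →a′) u≢v a≢a′
          where
          ν = node (y∈ →a)
          ν′ = node (y∈ →a′)

    black-ends : ∀ {i j} → E G i j ≡ black → i ≢ j
    black-ends {i} e refl with () ← trans (sym e) (E-irr G i)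

    outcome : ∀ {u v} → u ≢ v → AtMostTwo u v → ∀ {x y} → π x ≡ just u → π y ≡ just v → Outcome u v
    outcome {u} {v} u≢v bound x∈u y∈v
      -- A vertex of `G` that is black to both may have no surviving vertex of the subdivision below
      -- it; `alive?` rules this out.
      with any? (λ k → alive? k ×-dec ((E G u k ≟ᶜ black) ×-dec (E G v k ≟ᶜ black)))
    ... | yes (c , (z , z∈c) , cb@(uc , vc)) = go (node x∈u) (node y∈v)
      where
      u→c : Arc u c
      u→c = arc x∈u z∈c (full x∈u z∈c uc) (black-ends uc)
      v→c : Arc v c
      v→c = arc y∈v z∈c (full y∈v z∈c vc) (black-ends vc)
      open Black u≢v bound cb u→c v→c
      module Sw = Black (≢-sym u≢v) (swap-bound bound) (vc , uc) v→c u→c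
      go : Node u → Node v → Outcome u v
      go (inj₁ U) (inj₁ V) = two-two U V
      go (inj₁ U) (inj₂ V) = ⊥-elim (not-two-three U V)
      go (inj₂ U) (inj₁ V) = ⊥-elim (Sw.not-two-three V U)
      go (inj₂ U) (inj₂ V) = ⊥-elim (not-three-three U V)
    ... | no ¬c = go (node x∈u) (node y∈v)
      where
      open Plain u≢v bound (λ x∈k cb → ¬c (_ , (_ , x∈k) , cb))
      module Sw = Plain (≢-sym u≢v) (swap-bound bound) (λ x∈k cb → ¬c (_ , (_ , x∈k) , proj₂ cb , proj₁ cb))
      go : Node u → Node v → Outcome u v
      go (inj₁ U) (inj₁ V) = two-two U V
      go (inj₁ U) (inj₂ V) = ⊥-elim (not-two-three U V)
      go (inj₂ U) (inj₁ V) = ⊥-elim (Sw.not-two-three V U)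
      go (inj₂ U) (inj₂ V) = ⊥-elim (not-three-three U V)

-- One contraction: passing the invariant to the next quotient.

module Step {N} (Γ : LargeGirth N) {m} {G : Trigraph (suc m)} (s : Graph.State Γ G)
            (u v : Fin (suc m)) (u≢v : u ≢ v) where
  open LargeGirth Γ
  open Graph Γ
  open State s
  open Quotient u v u≢v
  open Lab

  G′ : Trigraph m
  G′ = contract G u v u≢v

  keep-all : Fin (suc m) → Bool
  keep-all _ = false

  bumped : Fin N → Fin N → Lab
  bumped x y = bump (lab x y)

  -- The cases of the step differ in which parts are discarded (`drop`) and in the new labelling
  -- (`lab′`); the rest is shared.
  module Next (drop : Fin (suc m) → Bool) (lab′ : Fin N → Fin N → Lab) where

    ρ : Fin (suc m) → Maybe (Fin m)
    ρ j = if drop j then nothing else just (q j)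

    π′ : Fin N → Maybe (Fin m)
    π′ x = π x >>= ρ

    module P′ = Parts π′ lab′

    up : ∀ {x I} → π x ≡ just I → drop I ≡ false → π′ x ≡ just (q I)
    up e d rewrite e | d = refl

    down : ∀ {x I′} → π′ x ≡ just I′ → ∃ λ I → π x ≡ just I × drop I ≡ false × q I ≡ I′
    down {x} e with π x
    ... | just I with drop I in d
    ... | false = I , refl , d , just-injective e

    -- An arc of the new quotient is an arc of the old one on the same edge. The arcs lost run
    -- between `u` and `v` or touch a dropped part.
    record Below {I′ J′} (α : P′.Arc I′ J′) : Set where
      constructor under
      field
        {I J} : Fin (suc m)
        x∈I   : π (P′.x α) ≡ just I
        y∈J   : π (P′.y α) ≡ just J
        I-kept : drop I ≡ false
        J-kept : drop J ≡ false
        qI    : q I ≡ I′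
        qJ    : q J ≡ J′

      base : Arc I J
      base = arc x∈I y∈J (P′.adj α) λ e → P′.ends≢ α (trans (sym qI) (trans (cong q e) qJ))

    below : ∀ {I′ J′} (α : P′.Arc I′ J′) → Below α
    below α with down (P′.x∈ α) | down (P′.y∈ α)
    ... | _ , a , b , c | _ , d , e , f = record
      { x∈I = a ; y∈J = d ; I-kept = b ; J-kept = e ; qI = c ; qJ = f }

    lift : ∀ {I J} → Arc I J → drop I ≡ false → drop J ≡ false → q I ≢ q J → P′.Arc (q I) (q J)
    lift α dI dJ n = P′.arc (up (x∈ α) dI) (up (y∈ α) dJ) (adj α) n

    q-sep : ∀ {I′ J′ I J} → I′ ≢ J′ → q I ≡ I′ → q J ≡ J′ → I ≢ J
    q-sep n eI eJ refl = n (trans (sym eI) eJ)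

    Unchanged : ∀ {J K} → Arc J K → Set
    Unchanged α = lab′ (x α) (y α) ≡ bump (ℓ α) × lab′ (y α) (x α) ≡ bump (ℓ (rev α))

    -- For parts away from the contraction: their neighbours survive and stay distinct, so the
    -- degree is kept, and bumping preserves the turns.
    transfer : ∀ {J z} → π z ≡ just J → drop J ≡ false →
      (∀ {J₂ y} → π y ≡ just J₂ → q J₂ ≡ q J → J₂ ≡ J) →
      (∀ {K} → Arc J K → drop K ≡ false) →
      (∀ {K K₂} → Arc J K → Arc J K₂ → q K ≡ q K₂ → K ≡ K₂) →
      (∀ {K} (α : Arc J K) → Unchanged α) →
      P′.Node (q J)
    transfer {J} z∈J dJ uniq live inj unch = go (node z∈J)
      where
      lift-nb : ∀ {K} → Arc J K → P′.Arc (q J) (q K)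
      lift-nb α = lift α dJ (live α) (λ e → ends≢ α (sym (uniq (y∈ α) (sym e))))

      turns′ : ∀ n → Turns n J → P′.Turns n (q J)
      turns′ n t I≢K α β with below α | below β
      ... | A@(under _ _ _ _ _ _) | B@(under _ _ _ _ _ _) with uniq (Below.y∈J A) (Below.qJ A) | uniq (Below.x∈I B) (Below.qI B)
                     | q-sep I≢K (Below.qI A) (Below.qJ B)
      ... | refl | refl | ne =
        subst₂ (Go n) (sym (proj₂ (unch (rev (Below.base A))))) (sym (proj₁ (unch (Below.base B))))
          (Go-bump n (t ne (Below.base A) (Below.base B)))

      only′ : ∀ {K′} → P′.Arc (q J) K′ → ∃ λ K → Arc J K × q K ≡ K′
      only′ α with below α
      ... | A@(under _ _ _ _ _ _) with uniq (Below.x∈I A) (Below.qI A)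
      ... | refl = _ , Below.base A , Below.qJ A

      go : Node J → P′.Node (q J)
      go (inj₁ (two p r p≢r →p →r only t)) = inj₁ (P′.two (q p) (q r) (p≢r ∘ inj →p →r)
        (lift-nb →p) (lift-nb →r)
        (λ α → let (K , β , e) = only′ α in
          [ (λ { refl → inj₁ (sym e) }) , (λ { refl → inj₂ (sym e) }) ]′ (only β))
        (turns′ 0 t))
      go (inj₂ (three p r w p≢r p≢w r≢w →p →r →w only t)) = inj₂ (P′.three (q p) (q r) (q w)
        (p≢r ∘ inj →p →r) (p≢w ∘ inj →p →w) (r≢w ∘ inj →r →w)
        (lift-nb →p) (lift-nb →r) (lift-nb →w)
        (λ α → let (K , β , e) = only′ α in
          [ (λ { refl → inj₁ (sym e) }) , [ (λ { refl → inj₂ (inj₁ (sym e)) }) , (λ { refl → inj₂ (inj₂ (sym e)) }) ]′ ]′ (only β))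
        (turns′ 1 t))

    -- Two arcs between the same new parts either join the same old parts, where `cons` applies, or
    -- reach a common neighbour of `u` and `v`, one from each; the hypothesis excludes the latter.
    agree : ∀ {I′ J′} (α β : P′.Arc I′ J′) →
      (∀ {K} → drop K ≡ false → Arc u K → Arc v K → (I′ ≡ q u × J′ ≡ q K) ⊎ (I′ ≡ q K × J′ ≡ q u) → ⊥) →
      bumped (P′.x α) (P′.y α) ≡ bumped (P′.x β) (P′.y β)
    agree α β none-common with below α | below β
    ... | A@(under _ _ _ _ _ _) | B@(under _ _ _ _ _ _) with q-reflects (trans (Below.qI A) (sym (Below.qI B)))
                   | q-reflects (trans (Below.qJ A) (sym (Below.qJ B)))
                   | Below.base A | Below.base B
    ... | equal | equal | _ | _ = cong bump (cons (Below.base A) (Below.base B))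
    ... | equal | uv | c | d = ⊥-elim (none-common (Below.I-kept A) (rev c) (rev d) (inj₂ (sym (Below.qI A) , sym (Below.qJ A))))
    ... | equal | vu | c | d = ⊥-elim (none-common (Below.I-kept A) (rev d) (rev c) (inj₂ (sym (Below.qI A) , sym (Below.qJ B))))
    ... | uv | equal | c | d = ⊥-elim (none-common (Below.J-kept A) c d (inj₁ (sym (Below.qI A) , sym (Below.qJ A))))
    ... | vu | equal | c | d = ⊥-elim (none-common (Below.J-kept A) d c (inj₁ (sym (Below.qI B) , sym (Below.qJ A))))
    ... | uv | uv | c | _ = ⊥-elim (ends≢ c refl)
    ... | vu | vu | c | _ = ⊥-elim (ends≢ c refl)
    ... | uv | vu | _ | _ = ⊥-elim (P′.ends≢ α (trans (sym (Below.qI A)) (Below.qJ B)))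
    ... | vu | uv | _ | _ = ⊥-elim (P′.ends≢ α (trans (sym (Below.qI A)) (Below.qJ B)))

    next : (∀ x y → tl (lab′ x y) ≢ hd (lab′ x y)) →
           (∀ {I J} (α β : P′.Arc I J) → P′.ℓ α ≡ P′.ℓ β) →
           (∀ {x J} → π x ≡ just J → drop J ≡ false → P′.Node (q J)) →
           (∃ λ x → ∃ λ J → π x ≡ just J × drop J ≡ false) →
           State G′
    next t≢h cons′ node′ (z , J , z∈J , dJ) = record
      { π = π′
      ; lab = lab′
      ; tl≢hd = t≢h
      ; cons = cons′
      ; seen = seen′
      ; full = full′
      ; node = λ e → let (_ , a , b , c) = down e in subst P′.Node c (node′ a b)
      ; some = z , q J , up z∈J dJ
      }
      where
      seen′ : ∀ {I J} → P′.Arc I J → E G′ I J ≢ none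
      seen′ α e with below α
      ... | record { x∈I = a ; y∈J = b ; qI = refl ; qJ = refl } =
        seen (arc a b (P′.adj α) λ { refl → P′.ends≢ α refl }) (contract-pure G (P′.ends≢ α) (λ ()) e)
      full′ : ∀ {x y I J} → π′ x ≡ just I → π′ y ≡ just J → E G′ I J ≡ black → x ~ y
      full′ ex ey e with down ex | down ey
      ... | I , a , _ , refl | J , b , _ , refl = full a b (contract-pure G sep (λ ()) e)
        where
        sep : q I ≢ q J
        sep qI≡qJ with () ← trans (sym e) (subst (λ j → E G′ (q I) j ≡ none) qI≡qJ (E-irr G′ (q I)))

  -- With `u` or `v` empty nothing is merged, and the parts are only renumbered.
  rename : ¬ (∃ λ x → π x ≡ just u) ⊎ ¬ (∃ λ x → π x ≡ just v) → State G′
  rename dead = next (λ x y → tl≢hd x y)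
    (λ α β → agree α β λ _ a b _ → [ (λ f → f (_ , x∈ a)) , (λ f → f (_ , x∈ b)) ]′ dead)
    (λ e d → transfer e d (λ e₂ eq → q-inj′ e₂ e eq) (λ _ → refl) (λ α β → q-inj′ (y∈ α) (y∈ β)) (λ _ → refl , refl))
    (let (x , J , e) = some in x , J , e , refl)
    where
    open Next keep-all bumped
    q-inj′ : ∀ {x y J K} → π x ≡ just J → π y ≡ just K → q J ≡ q K → J ≡ K
    q-inj′ ex ey eq with q-reflects eq
    ... | equal = refl
    ... | uv = ⊥-elim ([ (λ f → f (_ , ex)) , (λ f → f (_ , ey)) ]′ dead)
    ... | vu = ⊥-elim ([ (λ f → f (_ , ey)) , (λ f → f (_ , ex)) ]′ dead)

  UV : Fin (suc m) → Set
  UV j = j ≡ u ⊎ j ≡ v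

  uv? : ∀ j → Dec (UV j)
  uv? j = (j ≟ u) ⊎-dec (j ≟ v)

  q-UV : ∀ {j} → UV j → q j ≡ q u
  q-UV (inj₁ refl) = refl
  q-UV (inj₂ refl) = q-merges

  UV-q : ∀ {j} → q j ≡ q u → UV j
  UV-q e with q-reflects e
  ... | equal = inj₁ refl
  ... | uv = contradiction refl u≢v
  ... | vu = inj₂ refl

  q-inj-out : ∀ {j k} → ¬ UV j → q k ≡ q j → k ≡ j
  q-inj-out ¬j e = sym (q-inj (sym e) (¬j ∘ inj₁) (¬j ∘ inj₂))

  merge-nb : ∀ {J} → (Arc u J → Arc v J → ⊥) → ∀ {K K₂} → Arc J K → Arc J K₂ → q K ≡ q K₂ → K ≡ K₂
  merge-nb f α β e with q-reflects e
  ... | equal = refl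
  ... | uv = ⊥-elim (f (rev α) (rev β))
  ... | vu = ⊥-elim (f (rev β) (rev α))

  module Slide (U : Two u) (V : Two v) (pU : Two.p U ≡ v) (pV : Two.p V ≡ u) (a≢b : Two.q U ≢ Two.q V) where
    open Next keep-all bumped
    a = Two.q U
    b = Two.q V
    u→v : Arc u v
    u→v = subst (Arc u) pU (Two.→p U)

    a-out : ¬ UV a
    a-out (inj₁ e) = ends≢ (Two.→q U) (sym e)
    a-out (inj₂ e) = Two.p≢q U (trans pU (sym e))
    b-out : ¬ UV b
    b-out (inj₁ e) = Two.p≢q V (trans pV (sym e))
    b-out (inj₂ e) = ends≢ (Two.→q V) (sym e)

    no-common : ∀ {K} → Arc u K → Arc v K → ⊥
    no-common α β with Two.only U α | Two.only V β
    ... | inj₁ e | _ = ends≢ β (sym (trans e pU))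
    ... | inj₂ _ | inj₁ e = ends≢ α (sym (trans e pV))
    ... | inj₂ e | inj₂ e′ = a≢b (trans (sym e) e′)

    centre : P′.Node (q u)
    centre = inj₁ (P′.two (q a) (q b) (λ e → a≢b (q-inj-out b-out e))
      (lift (Two.→q U) refl refl (λ e → a-out (UV-q (sym e))))
      (subst (λ i → P′.Arc i (q b)) q-merges (lift (Two.→q V) refl refl (λ e → b-out (UV-q (trans (sym e) q-merges)))))
      only′ turn′)
      where
      only′ : ∀ {K′} → P′.Arc (q u) K′ → K′ ≡ q a ⊎ K′ ≡ q b
      only′ α with below α
      ... | A@(under _ _ _ _ _ _) with UV-q (Below.qI A) | Below.base A | Below.qI A | Below.qJ A
      ... | inj₁ refl | β | _ | refl with Two.only U β
      ... | inj₁ e = ⊥-elim (P′.ends≢ α (sym (trans (cong q (trans e pU)) q-merges)))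
      ... | inj₂ refl = inj₁ refl
      only′ α | A@(under _ _ _ _ _ _) | inj₂ refl | β | _ | refl with Two.only V β
      ... | inj₁ e = ⊥-elim (P′.ends≢ α (sym (cong q (trans e pV))))
      ... | inj₂ refl = inj₂ refl

      turn′ : P′.Turns 0 (q u)
      turn′ I≢K α β with below α | below β
      ... | A@(under _ _ _ _ _ _) | B@(under _ _ _ _ _ _) with UV-q (Below.qJ A) | UV-q (Below.qI B) | q-sep I≢K (Below.qI A) (Below.qJ B)
      ... | inj₁ refl | inj₁ refl | ne = Go-bump 0 (Two.turn U ne (Below.base A) (Below.base B))
      ... | inj₂ refl | inj₂ refl | ne = Go-bump 0 (Two.turn V ne (Below.base A) (Below.base B))
      -- The walk enters at `u` and leaves from `v`. The arc `u→v`, lost in the quotient, is put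
      -- back so that both old turns apply.
      ... | inj₁ refl | inj₂ refl | ne = Go-bump 0 (Go-trans 0 0
             (Two.turn U (λ { refl → P′.ends≢ α (trans (sym (Below.qI A)) q-merges) }) (Below.base A) u→v)
             (Two.turn V (λ { refl → P′.ends≢ β (Below.qJ B) }) u→v (Below.base B)))
      ... | inj₂ refl | inj₁ refl | ne = Go-bump 0 (Go-trans 0 0
             (Two.turn V (λ { refl → P′.ends≢ α (sym (Below.qI A)) }) (Below.base A) (rev u→v))
             (Two.turn U (λ { refl → P′.ends≢ β (trans (sym q-merges) (Below.qJ B)) }) (rev u→v) (Below.base B)))

    state : State G′
    state = next (λ x y → tl≢hd x y) (λ α β → agree α β λ _ c d _ → no-common c d) node′
      (_ , u , x∈ u→v , refl)
      where
      node′ : ∀ {x J} → π x ≡ just J → false ≡ false → P′.Node (q J)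
      node′ {x} {J} e d with uv? J
      ... | yes j = subst P′.Node (sym (q-UV j)) centre
      ... | no ¬j = transfer e d (λ _ → q-inj-out ¬j) (λ _ → refl) (merge-nb no-common) (λ _ → refl , refl)

  module Fold (U : Two u) (V : Two v) (pV : Two.p U ≡ Two.p V) (a≢b : Two.q U ≢ Two.q V) (¬uv : ¬ Arc u v) where
    a = Two.q U
    b = Two.q V
    c = Two.p U
    u→c : Arc u c
    u→c = Two.→p U
    v→c : Arc v c
    v→c = subst (Arc v) (sym pV) (Two.→p V)

    c-out : ¬ UV c
    c-out (inj₁ e) = ends≢ u→c (sym e)
    c-out (inj₂ e) = ends≢ v→c (sym e)
    a-out : ¬ UV a
    a-out (inj₁ e) = ends≢ (Two.→q U) (sym e)
    a-out (inj₂ e) = ¬uv (subst (Arc u) e (Two.→q U))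
    b-out : ¬ UV b
    b-out (inj₁ e) = ¬uv (rev (subst (Arc v) e (Two.→q V)))
    b-out (inj₂ e) = ends≢ (Two.→q V) (sym e)
    a≢c : a ≢ c
    a≢c = ≢-sym (Two.p≢q U)
    b≢c : b ≢ c
    b≢c e = Two.p≢q V (trans (sym pV) (sym e))

    onlyV : ∀ {K} → Arc v K → K ≡ c ⊎ K ≡ b
    onlyV α = [ (λ e → inj₁ (trans e (sym pV))) , inj₂ ]′ (Two.only V α)

    common : ∀ {K} → Arc u K → Arc v K → K ≡ c
    common α β with Two.only U α | onlyV β
    ... | inj₁ e | _ = e
    ... | inj₂ _ | inj₁ e = e
    ... | inj₂ e | inj₂ e′ = contradiction (trans (sym e) e′) a≢b

    -- The path `a u c v b` is shortened to `a`, the merged part, `b`. If kept, `c` would have a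
    -- single neighbour.
    module DropMiddle (T : Two c) where

      drop : Fin (suc m) → Bool
      drop j = does (j ≟ c)
      keep : ∀ {j} → j ≢ c → drop j ≡ false
      keep {j} = dec-false (j ≟ c)
      kept : ∀ {j} → drop j ≡ false → j ≢ c
      kept {j} d refl with () ← trans (sym (dec-true (c ≟ c) refl)) d

      open Next drop bumped

      c-only : ∀ {K} → Arc c K → UV K
      c-only α with front2 T (rev u→c)
      ... | T′ , e with Two.only T′ (rev v→c) | Two.only T′ α
      ... | inj₁ e₁ | _ = contradiction (sym (trans e₁ e)) u≢v
      ... | inj₂ _ | inj₁ e₂ = inj₁ (trans e₂ e)
      ... | inj₂ e₁ | inj₂ e₂ = inj₂ (trans e₂ (sym e₁))

      u≢c : u ≢ c
      u≢c = ends≢ u→c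
      v≢c : v ≢ c
      v≢c = ends≢ v→c

      centre : P′.Node (q u)
      centre = inj₁ (P′.two (q a) (q b) (λ e → a≢b (q-inj-out b-out e))
        (lift (Two.→q U) (keep u≢c) (keep a≢c) (λ e → a-out (UV-q (sym e))))
        (subst (λ i → P′.Arc i (q b)) q-merges
          (lift (Two.→q V) (keep v≢c) (keep b≢c) (λ e → b-out (UV-q (trans (sym e) q-merges)))))
        only′ turn′)
        where
        only′ : ∀ {K′} → P′.Arc (q u) K′ → K′ ≡ q a ⊎ K′ ≡ q b
        only′ α with below α
        ... | A@(under _ _ _ _ _ _) with UV-q (Below.qI A) | Below.base A | Below.qI A | Below.qJ A
        ... | inj₁ refl | β | _ | refl with Two.only U β
        ... | inj₁ e = contradiction e (kept (Below.J-kept A))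
        ... | inj₂ refl = inj₁ refl
        only′ α | A@(under _ _ _ _ _ _) | inj₂ refl | β | _ | refl with onlyV β
        ... | inj₁ e = contradiction e (kept (Below.J-kept A))
        ... | inj₂ refl = inj₂ refl

        turn′ : P′.Turns 0 (q u)
        turn′ I≢K α β with below α | below β
        ... | A@(under _ _ _ _ _ _) | B@(under _ _ _ _ _ _) with UV-q (Below.qJ A) | UV-q (Below.qI B) | q-sep I≢K (Below.qI A) (Below.qJ B)
                       | kept (Below.I-kept A) | kept (Below.J-kept B)
        ... | inj₁ refl | inj₁ refl | ne | _ | _ = Go-bump 0 (Two.turn U ne (Below.base A) (Below.base B))
        ... | inj₂ refl | inj₂ refl | ne | _ | _ = Go-bump 0 (Two.turn V ne (Below.base A) (Below.base B))
        -- The passage `u`, `c`, `v`, lost in the quotient, is inserted between the two arcs.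
        ... | inj₁ refl | inj₂ refl | ne | I≢c | K≢c = Go-bump 0 (Go-trans 0 0
               (Two.turn U I≢c (Below.base A) u→c)
               (Go-trans 0 0 (Two.turn T u≢v u→c (rev v→c))
               (Two.turn V (≢-sym K≢c) (rev v→c) (Below.base B))))
        ... | inj₂ refl | inj₁ refl | ne | I≢c | K≢c = Go-bump 0 (Go-trans 0 0
               (Two.turn V I≢c (Below.base A) v→c)
               (Go-trans 0 0 (Two.turn T (≢-sym u≢v) v→c (rev u→c))
               (Two.turn U (≢-sym K≢c) (rev u→c) (Below.base B))))

      state : State G′
      state = next (λ x y → tl≢hd x y) (λ α β → agree α β λ d e f _ → kept d (common e f)) node′
        (_ , u , x∈ u→c , keep u≢c)
        where
        node′ : ∀ {x J} → π x ≡ just J → drop J ≡ false → P′.Node (q J)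
        node′ {x} {J} e d with uv? J
        ... | yes j = subst P′.Node (sym (q-UV j)) centre
        ... | no ¬j = transfer e d (λ _ → q-inj-out ¬j)
                        (λ {K} α → keep {K} λ { refl → ¬j (c-only (rev α)) })
                        (merge-nb λ β γ → kept d (common β γ)) (λ _ → refl , refl)

    module MoveBranch (T : Three c) where

      third : ∃ λ w → ¬ UV w × Arc c w × (∀ {K} → Arc c K → UV K ⊎ K ≡ w)
      third with front3 T (rev u→c)
      ... | three _ p r u≢p u≢r p≢r _ →p →r only _ , refl with only (rev v→c)
      ... | inj₁ e = contradiction (sym e) u≢v
      ... | inj₂ (inj₁ refl) = r , [ ≢-sym u≢r , ≢-sym p≢r ]′ , →r ,
            λ α → [ inj₁ ∘ inj₁ , [ inj₁ ∘ inj₂ , inj₂ ]′ ]′ (only α)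
      ... | inj₂ (inj₂ refl) = p , [ ≢-sym u≢p , p≢r ]′ , →p ,
            λ α → [ inj₁ ∘ inj₁ , [ inj₂ , inj₁ ∘ inj₂ ]′ ]′ (only α)

      w = proj₁ third
      w-out = proj₁ (proj₂ third)
      c→w = proj₁ (proj₂ (proj₂ third))
      c-only = proj₂ (proj₂ (proj₂ third))

      -- The new part takes over the role of c as a branch vertex and c becomes
      -- its neighbour on the path towards w.
      out into : Lab
      out  = mkLab (tl (ℓ c→w)) (hd (ℓ c→w)) (2 + rk (ℓ c→w))
      into = mkLab (tl (ℓ (rev c→w))) (hd (ℓ (rev c→w))) 0

      InUV InC : Fin N → Set
      InUV x = π x ≡ just u ⊎ π x ≡ just v
      InC x = π x ≡ just c

      inUV? : ∀ x → Dec (InUV x)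
      inUV? x = maybe-≡-dec _≟_ (π x) (just u) ⊎-dec maybe-≡-dec _≟_ (π x) (just v)
      inC? : ∀ x → Dec (InC x)
      inC? x = maybe-≡-dec _≟_ (π x) (just c)

      relabel : {P Q : Set} → Dec P → Dec Q → Lab → Lab
      relabel (yes _) _       _ = out
      relabel (no _)  (yes _) _ = into
      relabel (no _)  (no _)  l = bump l

      lab′ : Fin N → Fin N → Lab
      lab′ x y = relabel (inUV? x ×-dec inC? y) (inC? x ×-dec inUV? y) (lab x y)

      disjoint : ∀ {x} → InUV x → InC x → ⊥
      disjoint (inj₁ e) e′ = c-out (inj₁ (just-injective (trans (sym e′) e)))
      disjoint (inj₂ e) e′ = c-out (inj₂ (just-injective (trans (sym e′) e)))

      lab-out : ∀ {x y} → InUV x → InC y → lab′ x y ≡ out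
      lab-out {x} {y} a b with inUV? x ×-dec inC? y
      ... | yes _ = refl
      ... | no f = contradiction (a , b) f

      lab-into : ∀ {x y} → InC x → InUV y → lab′ x y ≡ into
      lab-into {x} {y} a b with inUV? x ×-dec inC? y | inC? x ×-dec inUV? y
      ... | yes (a′ , _) | _ = ⊥-elim (disjoint a′ a)
      ... | no _ | yes _ = refl
      ... | no _ | no f = contradiction (a , b) f

      lab-else : ∀ {x y} → ¬ (InUV x × InC y) → ¬ (InC x × InUV y) → lab′ x y ≡ bump (lab x y)
      lab-else {x} {y} f g with inUV? x ×-dec inC? y | inC? x ×-dec inUV? y
      ... | yes p | _ = contradiction p f
      ... | no _ | yes p = contradiction p g
      ... | no _ | no _ = refl

      lab′-ends : ∀ x y → tl (lab′ x y) ≢ hd (lab′ x y)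
      lab′-ends x y with inUV? x ×-dec inC? y | inC? x ×-dec inUV? y
      ... | yes _ | _ = tl≢hd _ _
      ... | no _ | yes _ = tl≢hd _ _
      ... | no _ | no _ = tl≢hd _ _

      inUV : ∀ {x J} → π x ≡ just J → UV J → InUV x
      inUV e (inj₁ refl) = inj₁ e
      inUV e (inj₂ refl) = inj₂ e
      UV-of : ∀ {x J} → π x ≡ just J → InUV x → UV J
      UV-of e (inj₁ e′) = inj₁ (just-injective (trans (sym e) e′))
      UV-of e (inj₂ e′) = inj₂ (just-injective (trans (sym e) e′))
      C-of : ∀ {x J} → π x ≡ just J → InC x → J ≡ c
      C-of e e′ = just-injective (trans (sym e) e′)

      arc-else : ∀ {I J} (α : Arc I J) → ¬ (UV I × J ≡ c) → ¬ (I ≡ c × UV J) →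
        lab′ (x α) (y α) ≡ bump (ℓ α)
      arc-else α f g = lab-else (λ { (i , j) → f (UV-of (x∈ α) i , C-of (y∈ α) j) })
                                (λ { (i , j) → g (C-of (x∈ α) i , UV-of (y∈ α) j) })

      open Next keep-all lab′

      c≡ : ∀ {J} → q J ≡ q c → J ≡ c
      c≡ = q-inj-out c-out

      -- Only at `c`, the one common neighbour of `u` and `v`, could merged arcs disagree. There all
      -- of them now carry `out`, or `into` in the other direction.
      cons′ : ∀ {I′ J′} (α β : P′.Arc I′ J′) → P′.ℓ α ≡ P′.ℓ β
      cons′ {I′} {J′} α β with (I′ ≟ q u) ×-dec (J′ ≟ q c) | (I′ ≟ q c) ×-dec (J′ ≟ q u)
      ... | yes (refl , refl) | _ = trans (is-out α) (sym (is-out β))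
        where
        is-out : (α : P′.Arc (q u) (q c)) → P′.ℓ α ≡ out
        is-out α with below α
        ... | A@(under _ _ _ _ _ _) with c≡ (Below.qJ A) | Below.y∈J A
        ... | refl | j = lab-out (inUV (Below.x∈I A) (UV-q (Below.qI A))) j
      ... | no _ | yes (refl , refl) = trans (is-into α) (sym (is-into β))
        where
        is-into : (α : P′.Arc (q c) (q u)) → P′.ℓ α ≡ into
        is-into α with below α
        ... | A@(under _ _ _ _ _ _) with c≡ (Below.qI A) | Below.x∈I A
        ... | refl | i = lab-into i (inUV (Below.y∈J A) (UV-q (Below.qJ A)))
      ... | no f | no g = trans (plain α) (trans (agree α β no-common) (sym (plain β)))
        where
        no-common : ∀ {K} → false ≡ false → Arc u K → Arc v K →
          (I′ ≡ q u × J′ ≡ q K) ⊎ (I′ ≡ q K × J′ ≡ q u) → ⊥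
        no-common _ δ ε h with common δ ε
        ... | refl = [ f , g ]′ h
        plain : (α : P′.Arc I′ J′) → P′.ℓ α ≡ bumped (P′.x α) (P′.y α)
        plain α = arc-else (Below.base A)
          (λ { (i , j) → f (trans (sym (Below.qI A)) (q-UV i) , trans (sym (Below.qJ A)) (cong q j)) })
          (λ { (i , j) → g (trans (sym (Below.qI A)) (cong q i) , trans (sym (Below.qJ A)) (q-UV j)) })
          where A = below α

      stem : ∀ {I} → UV I → Arc I c
      stem (inj₁ refl) = u→c
      stem (inj₂ refl) = v→c

      reach : ∀ {I J} → UV J → (α : Arc I J) → I ≢ c → (σ : Arc J c) → Go 0 (ℓ α) (ℓ σ)
      reach (inj₁ refl) α I≢c σ = Two.turn U I≢c α σ
      reach (inj₂ refl) α I≢c σ = Two.turn V I≢c α σ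

      leave : ∀ {J K} → UV J → (σ : Arc c J) (β : Arc J K) → K ≢ c → Go 0 (ℓ σ) (ℓ β)
      leave (inj₁ refl) σ β K≢c = Two.turn U (≢-sym K≢c) σ β
      leave (inj₂ refl) σ β K≢c = Two.turn V (≢-sym K≢c) σ β

      w≢UV : ∀ {J} → UV J → J ≢ w
      w≢UV j refl = w-out j

      unique-side : ∀ {I J K} → UV J → Arc J I → Arc J K → I ≢ c → K ≢ c → I ≡ K
      unique-side (inj₁ refl) α β I≢c K≢c with Two.only U α | Two.only U β
      ... | inj₁ e | _ = contradiction e I≢c
      ... | inj₂ _ | inj₁ e = contradiction e K≢c
      ... | inj₂ e | inj₂ e′ = trans e (sym e′)
      unique-side (inj₂ refl) α β I≢c K≢c with onlyV α | onlyV β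
      ... | inj₁ e | _ = contradiction e I≢c
      ... | inj₂ _ | inj₁ e = contradiction e K≢c
      ... | inj₂ e | inj₂ e′ = trans e (sym e′)

      centre : P′.Node (q u)
      centre = inj₂ (P′.three (q c) (q a) (q b)
        (λ e → a≢c (sym (q-inj-out a-out e))) (λ e → b≢c (sym (q-inj-out b-out e)))
        (λ e → a≢b (q-inj-out b-out e))
        (lift u→c refl refl (λ e → c-out (UV-q (sym e))))
        (lift (Two.→q U) refl refl (λ e → a-out (UV-q (sym e))))
        (subst (λ i → P′.Arc i (q b)) q-merges (lift (Two.→q V) refl refl (λ e → b-out (UV-q (trans (sym e) q-merges)))))
        only′ turn′)
        where
        only′ : ∀ {K′} → P′.Arc (q u) K′ → K′ ≡ q c ⊎ K′ ≡ q a ⊎ K′ ≡ q b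
        only′ α with below α
        ... | A@(under _ _ _ _ _ _) with UV-q (Below.qI A) | Below.base A | Below.qI A | Below.qJ A
        ... | inj₁ refl | β | _ | refl with Two.only U β
        ... | inj₁ refl = inj₁ refl
        ... | inj₂ refl = inj₂ (inj₁ refl)
        only′ α | A@(under _ _ _ _ _ _) | inj₂ refl | β | _ | refl with onlyV β
        ... | inj₁ refl = inj₁ refl
        ... | inj₂ refl = inj₂ (inj₂ refl)

        -- Each passage through the merged part follows an old walk through `c` and inherits its
        -- turn there. `Go 1` does not look at ranks, so the old labels can stand for the bumped
        -- ones and for `out` and `into`.
        turn₀ : ∀ {I J J₂ K} → UV J → UV J₂ → I ≢ K → (α : Arc I J) (β : Arc J₂ K) →
          Go 1 (lab′ (x α) (y α)) (lab′ (x β) (y β))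
        turn₀ {I} {J} {J₂} {K} j j₂ I≢K α β with I ≟ c | K ≟ c
        ... | yes refl | yes refl = contradiction refl I≢K
        ... | yes refl | no K≢c = subst₂ (Go 1)
              (sym (lab-into (x∈ α) (inUV (y∈ α) j)))
              (sym (arc-else β (λ { (_ , e) → K≢c e }) (λ { (refl , _) → c-out j₂ })))
              (Go-trans 1 0 {ℓ (rev c→w)} {ℓ (rev (stem j₂))} {ℓ β} (Three.turn T (≢-sym (w≢UV j₂)) (rev c→w) (rev (stem j₂)))
                            (leave j₂ (rev (stem j₂)) β K≢c))
        ... | no I≢c | yes refl = subst₂ (Go 1)
              (sym (arc-else α (λ { (_ , refl) → c-out j }) (λ { (e , _) → I≢c e })))
              (sym (lab-out (inUV (x∈ β) j₂) (y∈ β)))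
              (Go-trans 0 1 {ℓ α} {ℓ (stem j)} {ℓ c→w} (reach j α I≢c (stem j)) (Three.turn T (w≢UV j) (stem j) c→w))
        ... | no I≢c | no K≢c = subst₂ (Go 1)
              (sym (arc-else α (λ { (_ , refl) → c-out j }) (λ { (e , _) → I≢c e })))
              (sym (arc-else β (λ { (_ , e) → K≢c e }) (λ { (refl , _) → c-out j₂ })))
              (Go-trans 0 1 {ℓ α} {ℓ (stem j)} {ℓ β} (reach j α I≢c (stem j))
                (Go-trans 1 0 {ℓ (stem j)} {ℓ (rev (stem j₂))} {ℓ β} (Three.turn T J≢J₂ (stem j) (rev (stem j₂)))
                              (leave j₂ (rev (stem j₂)) β K≢c)))
          where
          J≢J₂ : J ≢ J₂
          -- Otherwise `I` and `K` would both be the neighbour of `J` other than `c`.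
          J≢J₂ refl = I≢K (unique-side j (rev α) β I≢c K≢c)

        turn′ : P′.Turns 1 (q u)
        turn′ I≢K α β = turn₀ (UV-q (Below.qJ A)) (UV-q (Below.qI B))
          (q-sep I≢K (Below.qI A) (Below.qJ B)) (Below.base A) (Below.base B)
          where
          A = below α
          B = below β

      middle : P′.Node (q c)
      middle = inj₁ (P′.two (q w) (q u) (λ e → w-out (UV-q e))
        (lift c→w refl refl (λ e → ends≢ c→w (q-inj-out w-out e)))
        (lift (rev u→c) refl refl (λ e → c-out (UV-q e)))
        only′ turn′)
        where
        only′ : ∀ {K′} → P′.Arc (q c) K′ → K′ ≡ q w ⊎ K′ ≡ q u
        only′ α with below α
        ... | A@(under _ _ _ _ _ _) with c≡ (Below.qI A) | Below.base A
        ... | refl | β with c-only β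
        ... | inj₁ k = inj₂ (trans (sym (Below.qJ A)) (q-UV k))
        ... | inj₂ refl = inj₁ (sym (Below.qJ A))

        turn₀ : ∀ {I K} → q I ≢ q K → (α : Arc I c) (β : Arc c K) →
          Go 0 (lab′ (x α) (y α)) (lab′ (x β) (y β))
        turn₀ qI≢qK α β with c-only (rev α) | c-only β
        ... | inj₁ i | inj₁ k = contradiction (trans (q-UV i) (sym (q-UV k))) qI≢qK
        ... | inj₂ refl | inj₂ refl = contradiction refl qI≢qK
        -- The rank of `out` is 2 above the old rank of `c→w`, which is itself bumped by 1.
        ... | inj₁ i | inj₂ refl = subst₂ (Go 0)
              (sym (lab-out (inUV (x∈ α) i) (y∈ α)))
              (sym (trans (arc-else β (λ { (k , _) → c-out k }) (λ { (_ , k) → w-out k })) (cong bump (cons β c→w))))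
              (refl , refl , ≤-refl)
        -- The bumped label of the arc from `w` has positive rank, above the 0 of `into`.
        ... | inj₂ refl | inj₁ k = subst₂ (Go 0)
              (sym (trans (arc-else α (λ { (i , _) → w-out i }) (λ { (_ , i) → c-out i })) (cong bump (cons α (rev c→w)))))
              (sym (lab-into (x∈ β) (inUV (y∈ β) k)))
              (refl , refl , s≤s z≤n)

        turn′ : P′.Turns 0 (q c)
        turn′ I≢K α β with below α | below β
        ... | A@(under _ _ _ _ _ _) | B@(under _ _ _ _ _ _) with c≡ (Below.qJ A) | c≡ (Below.qI B)
        ... | refl | refl = turn₀ (λ e → I≢K (trans (sym (Below.qI A)) (trans e (Below.qJ B)))) (Below.base A) (Below.base B)

      state : State G′
      state = next lab′-ends cons′ node′ (_ , u , x∈ u→c , refl)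
        where
        node′ : ∀ {x J} → π x ≡ just J → false ≡ false → P′.Node (q J)
        node′ {x} {J} e d with uv? J | J ≟ c
        ... | yes j | _ = subst P′.Node (sym (q-UV j)) centre
        ... | no _ | yes refl = middle
        ... | no ¬j | no J≢c = transfer e d (λ _ → q-inj-out ¬j) (λ _ → refl)
                (merge-nb λ β γ → J≢c (common β γ))
                (λ α → arc-else α (λ { (j , _) → ¬j j }) (λ { (j , _) → J≢c j })
                     , arc-else (rev α) (λ { (_ , j) → J≢c j }) (λ { (_ , j) → ¬j j }))

    state : State G′
    state with node (y∈ u→c)
    ... | inj₁ T = DropMiddle.state T
    ... | inj₂ T = MoveBranch.state T

  module _ (bounded : RedBounded 2 G) (bounded′ : RedBounded 2 G′) where
    open Pair s bounded

    -- This is the only place where the red degree after the contraction enters.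
    at-most-two : AtMostTwo u v
    at-most-two i≢j i≢k j≢k ni nj nk = no-three-red {G = G′} bounded′ {i = q u}
      (sep ni i≢j) (sep ni i≢k) (sep nj j≢k) (is-red ni) (is-red nj) (is-red nk)
      where
      sep : ∀ {i j} → Nb u v i → i ≢ j → q i ≢ q j
      sep n i≢j e = i≢j (q-inj e (Nb.k≢u n) (Nb.k≢v n))
      is-red : ∀ {k} → Nb u v k → E G′ (q u) (q k) ≡ red
      is-red (nb k≢u k≢v joined ¬c) = contract-red G k≢u k≢v ¬c ([ inj₁ ∘ seen , inj₂ ∘ seen ]′ joined)

    advance : State G′
    advance with alive? u | alive? v
    ... | no ¬u | _ = rename (inj₁ ¬u)
    ... | yes _ | no ¬v = rename (inj₂ ¬v)
    ... | yes (_ , x∈u) | yes (_ , y∈v) with outcome u≢v at-most-two x∈u y∈v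
    ... | slide U V pU pV ne = Slide.state U V pU pV ne
    ... | fold U V pV ne ¬uv = Fold.state U V pV ne ¬uv

-- Following a whole contraction sequence.

module Run {N} (Γ : LargeGirth N) where
  open Graph Γ

  head-bounded : ∀ {d n} {G : Trigraph (suc n)} → ContrSeq d G → RedBounded d G
  head-bounded (done _ b) = b
  head-bounded (step _ b _ _ _ _) = b

  -- The invariant survives to the last trigraph, where a single part would need an arc to a
  -- different one.
  no-sequence : ∀ {n} {G : Trigraph (suc n)} → State G → ContrSeq 2 G → ⊥
  no-sequence s (done _ _) = single s
    where
    single : ∀ {G : Trigraph 1} → State G → ⊥
    single s with State.some s
    ... | _ , f0 , e = [ (λ T → no-nb (Two.→p T)) , (λ T → no-nb (Three.→p T)) ]′ (node e)
      where
      open State s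
      no-nb : ∀ {K} → Arc f0 K → ⊥
      no-nb {f0} α = ends≢ α refl
  no-sequence s (step _ b u v u≢v σ) = no-sequence (Step.advance Γ s u v u≢v b (head-bounded σ)) σ

-- Duplicate-free lists and walks.

module _ {A : Set} where

  Unique-reverse : {xs : List A} → Unique xs → Unique (reverse xs)
  Unique-reverse {xs} = SetoidPermutation.Unique-resp-↭ (setoid A) (↭⇒↭ₛ (↭-sym (↭-reverse xs)))

  reverse-mid : ∀ (as : List A) {x y bs} → reverse (as ++ x ∷ y ∷ bs) ≡ reverse bs ++ y ∷ x ∷ reverse as
  reverse-mid as {x} {y} {bs} = begin
    reverse (as ++ x ∷ y ∷ bs)              ≡⟨ reverse-++ as _ ⟩
    reverse (x ∷ y ∷ bs) ++ reverse as      ≡⟨ cong (_++ reverse as) (reverse-++ (x ∷ y ∷ []) bs) ⟩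
    (reverse bs ++ y ∷ x ∷ []) ++ reverse as ≡⟨ ++-assoc (reverse bs) _ _ ⟩
    reverse bs ++ y ∷ x ∷ reverse as        ∎
    where open ≡-Reasoning

  split-unique : ∀ (as as′ : List A) {x bs bs′} → Unique (as ++ x ∷ bs) → as ++ x ∷ bs ≡ as′ ++ x ∷ bs′ →
    as ≡ as′ × bs ≡ bs′
  split-unique [] [] _ e = refl , ∷-injectiveʳ e
  split-unique [] (a ∷ as′) {x} (h ∷ _) e with ∷-injective e
  ... | refl , refl = contradiction refl (All.lookup h (∈-++⁺ʳ as′ (here refl)))
  split-unique (a ∷ as) [] {x} (h ∷ _) e with ∷-injective e
  ... | refl , _ = contradiction refl (All.lookup h (∈-++⁺ʳ as (here refl)))
  split-unique (a ∷ as) (a′ ∷ as′) (_ ∷ u) e with ∷-injective e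
  ... | refl , e′ with split-unique as as′ u e′
  ... | refl , r = refl , r

  not-repeated : ∀ (as cs : List A) {x bs} → Unique (as ++ x ∷ cs ++ x ∷ bs) → ⊥
  not-repeated [] cs (h ∷ _) = All.lookup h (∈-++⁺ʳ cs (here refl)) refl
  not-repeated (_ ∷ as) cs (_ ∷ u) = not-repeated as cs u

  -- The equality of lengths makes the rank of a label well defined.
  successor-unique : ∀ (as as′ : List A) {x y y′ bs bs′ l} → Unique l → l ≡ as ++ x ∷ y ∷ bs →
    l ≡ as′ ++ x ∷ y′ ∷ bs′ → y ≡ y′ × length bs ≡ length bs′
  successor-unique as as′ u refl e with split-unique as as′ u e
  ... | _ , refl = refl , refl

  -- The two occurrences of `x` are the same, so `y` would stand on either side of it.
  not-both-ways : ∀ (as as′ : List A) {x y bs bs′ l} → Unique l → l ≡ as ++ x ∷ y ∷ bs →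
    l ≡ as′ ++ y ∷ x ∷ bs′ → ⊥
  not-both-ways as as′ {x} {y} u refl e
    with split-unique as (as′ ∷ʳ y) u (trans e (sym (++-assoc as′ [ y ] _)))
  ... | refl , _ = not-repeated as′ [ x ] (subst Unique (++-assoc as′ [ y ] _) u)

  last-snoc : ∀ (xs : List A) z → last (xs ∷ʳ z) ≡ just z
  last-snoc [] z = refl
  last-snoc (_ ∷ []) z = refl
  last-snoc (_ ∷ xs@(_ ∷ _)) z = last-snoc xs z

  ends-shape : ∀ (l : List A) {x y} → head l ≡ just x → last l ≡ just y → x ≢ y → ∃ λ ms → l ≡ x ∷ ms ∷ʳ y
  ends-shape (x ∷ l) refl e x≢y with initLast l
  ... | [] = contradiction (just-injective e) x≢y
  ... | ms ∷ʳ′ z = ms , cong (λ z → x ∷ ms ∷ʳ z) (just-injective (trans (sym (last-snoc (x ∷ ms) z)) e))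

Walk-mid : ∀ {n} {R : Fin n → Fin n → Set} as {x y bs} → Walk R (as ++ x ∷ y ∷ bs) → R x y
Walk-mid [] (r , _) = r
Walk-mid (_ ∷ []) (_ , r , _) = r
Walk-mid (_ ∷ as@(_ ∷ _)) (_ , w) = Walk-mid as w

-- Edges and directed edges of K₄.

End : Fin 6 → Fin 4 → Set
End e k = k ≡ k4src e ⊎ k ≡ k4tgt e

end? : ∀ e k → Dec (End e k)
end? e k = (k ≟ k4src e) ⊎-dec (k ≟ k4tgt e)

abstract
  -- K₄ has no parallel edges. The proof runs through all cases, and `abstract` keeps it from being
  -- unfolded later.
  edge-unique : ∀ e e′ k l → k ≢ l → End e k → End e l → End e′ k → End e′ l → e ≡ e′
  edge-unique = from-yes (all? λ e → all? λ e′ → all? λ k → all? λ l →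
    ¬? (k ≟ l) →-dec (end? e k →-dec (end? e l →-dec (end? e′ k →-dec (end? e′ l →-dec (e ≟ e′))))))

  src≢tgt : ∀ e → k4src e ≢ k4tgt e
  src≢tgt = from-yes (all? λ e → ¬? (k4src e ≟ k4tgt e))

Dart : Set
Dart = Fin 6 × Bool

src tgt : Dart → Fin 4
src (e , true)  = k4src e
src (e , false) = k4tgt e
tgt (e , true)  = k4tgt e
tgt (e , false) = k4src e

opp : Dart → Dart
opp (e , o) = e , not o

src-opp : ∀ d → src (opp d) ≡ tgt d
src-opp (e , true) = refl
src-opp (e , false) = refl

tgt-opp : ∀ d → tgt (opp d) ≡ src d
tgt-opp (e , true) = refl
tgt-opp (e , false) = refl

dart-ends : ∀ d → src d ≢ tgt d
dart-ends (e , true) = src≢tgt e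
dart-ends (e , false) = ≢-sym (src≢tgt e)

src-End : ∀ d → End (proj₁ d) (src d)
src-End (e , true) = inj₁ refl
src-End (e , false) = inj₂ refl

tgt-End : ∀ d → End (proj₁ d) (tgt d)
tgt-End (e , true) = inj₂ refl
tgt-End (e , false) = inj₁ refl

End-dart : ∀ d {k} → End (proj₁ d) k → k ≡ src d ⊎ k ≡ tgt d
End-dart (e , true) (inj₁ p) = inj₁ p
End-dart (e , true) (inj₂ p) = inj₂ p
End-dart (e , false) (inj₁ p) = inj₂ p
End-dart (e , false) (inj₂ p) = inj₁ p

same-edge : ∀ d d′ → proj₁ d ≡ proj₁ d′ → d′ ≡ d ⊎ d′ ≡ opp d
same-edge (_ , true) (_ , true) refl = inj₁ refl
same-edge (_ , true) (_ , false) refl = inj₂ refl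
same-edge (_ , false) (_ , true) refl = inj₂ refl
same-edge (_ , false) (_ , false) refl = inj₁ refl

dart-unique : ∀ d d′ → src d ≡ src d′ → tgt d ≡ tgt d′ → d ≡ d′
dart-unique d d′ s t with same-edge d d′ (edge-unique _ _ _ _ (dart-ends d) (src-End d) (tgt-End d)
    (subst (End _) (sym s) (src-End d′)) (subst (End _) (sym t) (tgt-End d′)))
... | inj₁ e = sym e
... | inj₂ refl = contradiction (trans s (src-opp d)) (dart-ends d)

abstract
  -- `punchIn k` lists the three vertices other than `k`; this will give each branch vertex its
  -- three neighbours.
  dart-between : ∀ k i → ∃ λ d → src d ≡ k × tgt d ≡ punchIn k i
  dart-between k i = orient (from-yes (all? λ k → all? λ i → any? λ e →
      ((k4src e ≟ k) ×-dec (k4tgt e ≟ punchIn k i)) ⊎-dec ((k4tgt e ≟ k) ×-dec (k4src e ≟ punchIn k i))) k i)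
    where
    orient : (∃ λ e → (k4src e ≡ k × k4tgt e ≡ punchIn k i) ⊎ (k4tgt e ≡ k × k4src e ≡ punchIn k i)) →
      ∃ λ d → src d ≡ k × tgt d ≡ punchIn k i
    orient (e , inj₁ p) = (e , true) , p
    orient (e , inj₂ p) = (e , false) , p

-- The subdivision itself as the first quotient.

module Initial {N} (H : Trigraph N) (K : InducedK4Subdivision (Adj H)) (girth : GirthAtLeast 7 K) where
  open InducedK4Subdivision K

  _~_ : Fin N → Fin N → Set
  x ~ y = Adj H x y × InS x × InS y

  ~-sym : ∀ {x y} → x ~ y → y ~ x
  ~-sym {x} {y} (r , sx , sy) = (λ e → r (trans (E-sym H x y) e)) , sy , sx

  ~⇒≢ : ∀ {x y} → x ~ y → x ≢ y
  ~⇒≢ {x} (r , _) refl = r (E-irr H x)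

  no3 : ∀ {a b c} → a ~ b → b ~ c → c ~ a → ⊥
  no3 ab bc ca = short (girth (_ ∷ _ ∷ _ ∷ [])
    ( s≤s (s≤s (s≤s z≤n))
    , (~⇒≢ ab ∷ ≢-sym (~⇒≢ ca) ∷ []) ∷ (~⇒≢ bc ∷ []) ∷ [] ∷ []
    , proj₁ (proj₂ ab) ∷ proj₁ (proj₂ bc) ∷ proj₁ (proj₂ ca) ∷ []
    , (proj₁ ab , proj₁ bc , tt)
    , _ , _ , refl , refl , proj₁ ca ))
    where
    short : ¬ 7 ≤ 3
    short (s≤s (s≤s (s≤s ())))

  no4 : ∀ {a b c d} → a ~ b → b ~ c → c ~ d → d ~ a → a ≢ c → b ≢ d → ⊥
  no4 ab bc cd da a≢c b≢d = short (girth (_ ∷ _ ∷ _ ∷ _ ∷ [])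
    ( s≤s (s≤s (s≤s z≤n))
    , (~⇒≢ ab ∷ a≢c ∷ ≢-sym (~⇒≢ da) ∷ []) ∷ (~⇒≢ bc ∷ b≢d ∷ []) ∷ (~⇒≢ cd ∷ []) ∷ [] ∷ []
    , proj₁ (proj₂ ab) ∷ proj₁ (proj₂ bc) ∷ proj₁ (proj₂ cd) ∷ proj₁ (proj₂ da) ∷ []
    , (proj₁ ab , proj₁ bc , proj₁ cd , tt)
    , _ , _ , refl , refl , proj₁ da ))
    where
    short : ¬ 7 ≤ 4
    short (s≤s (s≤s (s≤s (s≤s ()))))

  no5 : ∀ {a b c d e} → a ~ b → b ~ c → c ~ d → d ~ e → e ~ a → ⊥
  no5 {a} {b} {c} {d} {e} ab bc cd de ea with a ≟ c | b ≟ d | c ≟ e | d ≟ a | e ≟ b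
  ... | yes refl | _ | _ | _ | _ = no3 cd de ea
  ... | no _ | yes refl | _ | _ | _ = no3 de ea ab
  ... | no _ | no _ | yes refl | _ | _ = no3 ea ab bc
  ... | no _ | no _ | no _ | yes refl | _ = no3 ab bc cd
  ... | no _ | no _ | no _ | no _ | yes refl = no3 bc cd de
  ... | no a≢c | no b≢d | no c≢e | no d≢a | no e≢b = short (girth (_ ∷ _ ∷ _ ∷ _ ∷ _ ∷ [])
    ( s≤s (s≤s (s≤s z≤n))
    , (~⇒≢ ab ∷ a≢c ∷ ≢-sym d≢a ∷ ≢-sym (~⇒≢ ea) ∷ []) ∷ (~⇒≢ bc ∷ b≢d ∷ ≢-sym e≢b ∷ [])
      ∷ (~⇒≢ cd ∷ c≢e ∷ []) ∷ (~⇒≢ de ∷ []) ∷ [] ∷ []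
    , proj₁ (proj₂ ab) ∷ proj₁ (proj₂ bc) ∷ proj₁ (proj₂ cd) ∷ proj₁ (proj₂ de) ∷ proj₁ (proj₂ ea) ∷ []
    , (proj₁ ab , proj₁ bc , proj₁ cd , proj₁ de , tt)
    , _ , _ , refl , refl , proj₁ ea ))
    where
    short : ¬ 7 ≤ 5
    short (s≤s (s≤s (s≤s (s≤s (s≤s ())))))

  -- Opposite vertices that coincide leave a triangle; otherwise all six are distinct and form a
  -- cycle.
  no6 : ∀ {a b c d e f} → a ~ b → b ~ c → c ~ d → d ~ e → e ~ f → f ~ a →
    a ≢ c → b ≢ d → c ≢ e → d ≢ f → e ≢ a → f ≢ b → ⊥
  no6 {a} {b} {c} {d} {e} {f} ab bc cd de ef fa a≢c b≢d c≢e d≢f e≢a f≢b with a ≟ d | b ≟ e | c ≟ f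
  ... | yes refl | _ | _ = no3 ab bc cd
  ... | no _ | yes refl | _ = no3 bc cd de
  ... | no _ | no _ | yes refl = no3 cd de ef
  ... | no a≢d | no b≢e | no c≢f = short (girth (_ ∷ _ ∷ _ ∷ _ ∷ _ ∷ _ ∷ [])
    ( s≤s (s≤s (s≤s z≤n))
    , (~⇒≢ ab ∷ a≢c ∷ a≢d ∷ ≢-sym e≢a ∷ ≢-sym (~⇒≢ fa) ∷ []) ∷ (~⇒≢ bc ∷ b≢d ∷ b≢e ∷ ≢-sym f≢b ∷ [])
      ∷ (~⇒≢ cd ∷ c≢e ∷ c≢f ∷ []) ∷ (~⇒≢ de ∷ d≢f ∷ []) ∷ (~⇒≢ ef ∷ []) ∷ [] ∷ []
    , proj₁ (proj₂ ab) ∷ proj₁ (proj₂ bc) ∷ proj₁ (proj₂ cd) ∷ proj₁ (proj₂ de)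
      ∷ proj₁ (proj₂ ef) ∷ proj₁ (proj₂ fa) ∷ []
    , (proj₁ ab , proj₁ bc , proj₁ cd , proj₁ de , proj₁ ef , tt)
    , _ , _ , refl , refl , proj₁ fa ))
    where
    short : ¬ 7 ≤ 6
    short (s≤s (s≤s (s≤s (s≤s (s≤s (s≤s ()))))))

  Γ : LargeGirth N
  Γ = record { _~_ = _~_ ; ~-sym = ~-sym ; no3 = no3 ; no4 = no4 ; no5 = no5 ; no6 = no6 }

  path : Dart → List (Fin N)
  path (e , true)  = P e
  path (e , false) = reverse (P e)

  path-opp : ∀ d → path (opp d) ≡ reverse (path d)
  path-opp (e , true) = refl
  path-opp (e , false) = sym (reverse-involutive (P e))

  path-uniq : ∀ d → Unique (path d)
  path-uniq (e , true) = P-uniq e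
  path-uniq (e , false) = Unique-reverse (P-uniq e)

  path-shape : ∀ d → ∃ λ ms → path d ≡ b (src d) ∷ ms ∷ʳ b (tgt d)
  path-shape (e , true) = ends-shape (P e) (P-head e) (P-last e) (src≢tgt e ∘ b-inj _ _)
  path-shape (e , false) with ends-shape (P e) (P-head e) (P-last e) (src≢tgt e ∘ b-inj _ _)
  ... | ms , eq = reverse ms , (begin
    reverse (P e)                                      ≡⟨ cong reverse eq ⟩
    reverse (b (k4src e) ∷ ms ∷ʳ b (k4tgt e))          ≡⟨ unfold-reverse (b (k4src e)) (ms ∷ʳ b (k4tgt e)) ⟩
    reverse (ms ∷ʳ b (k4tgt e)) ∷ʳ b (k4src e)         ≡⟨ cong (_∷ʳ b (k4src e)) (reverse-++ ms [ b (k4tgt e) ]) ⟩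
    b (k4tgt e) ∷ reverse ms ∷ʳ b (k4src e)            ∎)
    where open ≡-Reasoning

  path-∈ : ∀ d {x} → x ∈ path d → x ∈ P (proj₁ d)
  path-∈ (e , true) x∈ = x∈
  path-∈ (e , false) x∈ = Any-reverse⁻ x∈

  record On (x y : Fin N) : Set where
    constructor on
    field
      d       : Dart
      as {bs} : List (Fin N)
      eq      : path d ≡ as ++ x ∷ y ∷ bs

  flip-eq : ∀ d as {x y bs} → path d ≡ as ++ x ∷ y ∷ bs → path (opp d) ≡ reverse bs ++ y ∷ x ∷ reverse as
  flip-eq d as eq = trans (path-opp d) (trans (cong reverse eq) (reverse-mid as))

  locate : ∀ {x y} → x ~ y → On x y
  locate {x} {y} (r , sx , sy) with induced x y sx sy r
  ... | e , inj₁ (as , bs , eq) = on (e , true) as eq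
  ... | e , inj₂ (as , bs , eq) = on (e , false) (reverse bs) (flip-eq (e , true) as eq)

  fst-∈ : ∀ d as {x y bs} → path d ≡ as ++ x ∷ y ∷ bs → x ∈ P (proj₁ d)
  fst-∈ d as eq = path-∈ d (subst (_ ∈_) (sym eq) (∈-++⁺ʳ as (here refl)))

  snd-∈ : ∀ d as {x y bs} → path d ≡ as ++ x ∷ y ∷ bs → y ∈ P (proj₁ d)
  snd-∈ d as eq = path-∈ d (subst (_ ∈_) (sym eq) (∈-++⁺ʳ as (there (here refl))))

  step-~ : ∀ d as {x y bs} → path d ≡ as ++ x ∷ y ∷ bs → x ~ y
  step-~ (e , true) as eq =
    Walk-mid as (subst (Walk (Adj H)) eq (P-walk e)) , (e , fst-∈ (e , true) as eq) , (e , snd-∈ (e , true) as eq)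
  step-~ (e , false) as {x} {y} {bs} eq = ~-sym
    ( Walk-mid (reverse bs) (subst (Walk (Adj H)) (flip-eq (e , false) as eq) (P-walk e))
    , (e , snd-∈ (e , false) as eq) , (e , fst-∈ (e , false) as eq))

  -- On one edge of K₄, `not-both-ways` fixes the direction. On two different edges, `x` and `y`
  -- would be branch vertices and common ends of both, but K₄ has no parallel edges.
  step-dart : ∀ d d′ as as′ {x y bs bs′} → path d ≡ as ++ x ∷ y ∷ bs → path d′ ≡ as′ ++ x ∷ y ∷ bs′ → d ≡ d′
  step-dart d d′ as as′ {x} {y} {bs} eq eq′ with proj₁ d ≟ proj₁ d′
  ... | yes e with same-edge d d′ e
  ... | inj₁ e′ = sym e′
  ... | inj₂ refl = ⊥-elim (not-both-ways as′ (reverse bs) (path-uniq (opp d)) eq′ (flip-eq d as eq))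
  step-dart d d′ as as′ {x} {y} eq eq′ | no e≢
    with P-disj _ _ x e≢ (fst-∈ d as eq) (fst-∈ d′ as′ eq′) | P-disj _ _ y e≢ (snd-∈ d as eq) (snd-∈ d′ as′ eq′)
  ... | k , refl | l , refl = contradiction
    (edge-unique _ _ k l (λ { refl → ~⇒≢ (step-~ d as eq) refl })
      (P-branch _ k (fst-∈ d as eq)) (P-branch _ l (snd-∈ d as eq))
      (P-branch _ k (fst-∈ d′ as′ eq′)) (P-branch _ l (snd-∈ d′ as′ eq′))) e≢

  inS? : ∀ x → Dec (InS x)
  inS? x = any? λ e → x ∈? P e
    where open DecMembership _≟_ using (_∈?_)

  _~?_ : ∀ x y → Dec (x ~ y)
  x ~? y = ¬? (E H x y ≟ᶜ none) ×-dec (inS? x ×-dec inS? y)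

  -- The rank is the number of vertices after `y` on the path, so it drops by one with each step.
  on-lab : ∀ {x y} → On x y → Lab
  on-lab (on d as {bs} _) = mkLab (src d) (tgt d) (length bs)

  lab : Fin N → Fin N → Lab
  lab x y with x ~? y
  ... | yes e = on-lab (locate e)
  -- A default with distinct ends, since `tl≢hd` ranges over all pairs of vertices.
  ... | no _  = mkLab f0 (fs f0) 0

  on-lab-unique : ∀ {x y} (o o′ : On x y) → on-lab o ≡ on-lab o′
  on-lab-unique (on d as eq) (on d′ as′ eq′) with step-dart d d′ as as′ eq eq′
  ... | refl = cong (mkLab _ _) (proj₂ (successor-unique as as′ (path-uniq d) eq eq′))

  lab-on : ∀ {x y} (o : On x y) → lab x y ≡ on-lab o
  lab-on {x} {y} o@(on d as eq) with x ~? y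
  ... | yes e = on-lab-unique (locate e) o
  ... | no f = contradiction (step-~ d as eq) f

  lab-ends : ∀ x y → Lab.tl (lab x y) ≢ Lab.hd (lab x y)
  lab-ends x y with x ~? y
  ... | yes e = dart-ends (On.d (locate e))
  ... | no _ = λ ()

  π : Fin N → Maybe (Fin N)
  π x with inS? x
  ... | yes _ = just x
  ... | no _  = nothing

  π-in : ∀ {x} → InS x → π x ≡ just x
  π-in {x} sx with inS? x
  ... | yes _ = refl
  ... | no f = contradiction sx f

  π-out : ∀ {x J} → π x ≡ just J → x ≡ J × InS x
  π-out {x} e with inS? x
  ... | yes sx = just-injective e , sx

  open Graph Γ
  open Parts π lab

  mkArc : ∀ {x y} → x ~ y → Arc x y
  mkArc e@(_ , sx , sy) = arc (π-in sx) (π-in sy) e (~⇒≢ e)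

  unArc : ∀ {x y} (α : Arc x y) → x ~ y × ℓ α ≡ lab x y
  unArc (arc xi yj e _) with π-out xi | π-out yj
  ... | refl , _ | refl , _ = e , refl

  turns-from : ∀ n {y} → (∀ {x z} → x ≢ z → x ~ y → y ~ z → Go n (lab x y) (lab y z)) → Turns n y
  turns-from n f x≢z α β with unArc α | unArc β
  ... | e , l | e′ , l′ = subst₂ (Go n) (sym l) (sym l′) (f x≢z e e′)

  module Interior {y} (not-branch : ∀ k → y ≢ b k) (d : Dart) (as : List (Fin N)) {p z bs}
                  (eq : path d ≡ as ++ p ∷ y ∷ z ∷ bs) where

    eq₁ : path d ≡ (as ∷ʳ p) ++ y ∷ z ∷ bs
    eq₁ = trans eq (sym (++-assoc as [ p ] _))

    one-edge : ∀ {e} → y ∈ P e → proj₁ d ≡ e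
    one-edge {e} y∈ with proj₁ d ≟ e
    ... | yes q = q
    ... | no ne = let (k , q) = P-disj _ _ y ne (snd-∈ d as eq) y∈ in contradiction q (not-branch k)

    only : ∀ {k} → y ~ k → k ≡ p ⊎ k ≡ z
    only y~k with locate y~k
    ... | on d′ as′ eq′ with same-edge d d′ (one-edge (fst-∈ d′ as′ eq′))
    -- Along `d` the vertex after `y` is `z`; along the opposite dart it is `p`.
    ... | inj₁ refl = inj₂ (proj₁ (successor-unique as′ (as ∷ʳ p) (path-uniq d) eq′ eq₁))
    ... | inj₂ refl = inj₁ (proj₁ (successor-unique as′ _ (path-uniq (opp d)) eq′ (flip-eq d as eq)))

    p≢z : p ≢ z
    p≢z refl = not-repeated as [ y ] (subst Unique eq (path-uniq d))

    turn : ∀ {x w} → x ≢ w → x ~ y → y ~ w → Go 0 (lab x y) (lab y w)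
    turn x≢w x~y y~w with only (~-sym x~y) | only y~w
    ... | inj₁ refl | inj₁ refl = contradiction refl x≢w
    ... | inj₂ refl | inj₂ refl = contradiction refl x≢w
    ... | inj₁ refl | inj₂ refl = subst₂ (Go 0) (sym (lab-on (on d as eq))) (sym (lab-on (on d _ eq₁)))
            (refl , refl , ≤-refl)
    ... | inj₂ refl | inj₁ refl = subst₂ (Go 0)
            (sym (lab-on (on (opp d) (reverse bs) eq₂))) (sym (lab-on (on (opp d) _ (trans eq₂ (sym (++-assoc _ [ z ] _))))))
            (refl , refl , ≤-refl)
      where
      eq₂ : path (opp d) ≡ reverse bs ++ z ∷ y ∷ p ∷ reverse as
      eq₂ = trans (flip-eq d (as ∷ʳ p) eq₁) (cong (λ t → reverse bs ++ z ∷ y ∷ t) (reverse-++ as [ p ]))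

    interior : Two y
    interior = two p z p≢z (mkArc (~-sym (step-~ d as eq))) (mkArc (step-~ d (as ∷ʳ p) eq₁))
      (only ∘ proj₁ ∘ unArc) (turns-from 0 turn)

  module Branch (k : Fin 4) where

    -- If `b k` were the target of `d`, it would be the last vertex of the path and have no
    -- successor.
    src-out : ∀ d as {z bs} → path d ≡ as ++ b k ∷ z ∷ bs → src d ≡ k
    src-out d as {z} {bs} eq with End-dart d (P-branch _ k (fst-∈ d as eq))
    ... | inj₁ e = sym e
    ... | inj₂ refl with path-shape d
    ... | ms , shape with split-unique (b (src d) ∷ ms) as (subst Unique shape (path-uniq d)) (trans (sym shape) eq)
    ... | _ , ()

    tgt-in : ∀ d as {x bs} → path d ≡ as ++ x ∷ b k ∷ bs → tgt d ≡ k
    tgt-in d as eq = trans (sym (src-opp d)) (src-out (opp d) _ (flip-eq d as eq))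

    turn : ∀ {x z} → x ≢ z → x ~ b k → b k ~ z → Go 1 (lab x (b k)) (lab (b k) z)
    turn x≢z x~ ~z with locate x~ | locate ~z
    ... | o@(on d as eq) | o′@(on d′ as′ eq′) = subst₂ (Go 1) (sym (lab-on o)) (sym (lab-on o′))
      (trans (src-out d′ as′ eq′) (sym (tgt-in d as eq)) , back)
      where
      back : tgt d′ ≢ src d
      -- A dart from `k` back to `src d` is the opposite of `d`, so the walk would return to `x`.
      back t with dart-unique d′ (opp d)
                    (trans (src-out d′ as′ eq′) (trans (sym (tgt-in d as eq)) (sym (src-opp d))))
                    (trans t (sym (tgt-opp d)))
      ... | refl = x≢z (proj₁ (successor-unique _ as′ (path-uniq (opp d)) (flip-eq d as eq) eq′))

    first : ∀ i → ∃ λ d → src d ≡ k × tgt d ≡ punchIn k i × (∃ λ y → ∃ λ bs → path d ≡ b k ∷ y ∷ bs)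
    first i with dart-between k i
    ... | d , refl , t with path-shape d
    ... | [] , eq = d , refl , t , _ , _ , eq
    ... | _ ∷ _ , eq = d , refl , t , _ , _ , eq

    nbr : Fin 3 → Fin N
    nbr i = let (_ , _ , _ , y , _) = first i in y

    nbr-arc : ∀ i → Arc (b k) (nbr i)
    nbr-arc i = let (d , _ , _ , _ , _ , eq) = first i in mkArc (step-~ d [] eq)

    nbr-inj : ∀ i j → nbr i ≡ nbr j → i ≡ j
    nbr-inj i j e with first i | first j
    ... | d , _ , t , y , _ , eq | d′ , _ , t′ , y′ , _ , eq′ with e
    ... | refl with step-dart d d′ [] [] eq eq′
    ... | refl = punchIn-injective k i j (trans (sym t) t′)

    nbr-only : ∀ {z} → b k ~ z → ∃ λ i → z ≡ nbr i
    nbr-only ~z with locate ~z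
    ... | on d as eq with src-out d as eq
    ... | refl = i , found
      where
      i : Fin 3
      i = punchOut (dart-ends d)
      found : _ ≡ nbr i
      found with first i
      ... | d′ , s , t , _ , _ , eq′ with dart-unique d d′ (sym s) (sym (trans t (punchIn-punchOut (dart-ends d))))
      ... | refl = proj₁ (successor-unique as [] (path-uniq d) eq eq′)

    branch : Three (b k)
    branch = three (nbr f0) (nbr (fs f0)) (nbr (fs (fs f0)))
      (λ e → contradiction (nbr-inj _ _ e) λ ()) (λ e → contradiction (nbr-inj _ _ e) λ ())
      (λ e → contradiction (nbr-inj _ _ e) λ ())
      (nbr-arc _) (nbr-arc _) (nbr-arc _) (only ∘ proj₁ ∘ unArc) (turns-from 1 turn)
      where
      only : ∀ {z} → b k ~ z → z ≡ nbr f0 ⊎ z ≡ nbr (fs f0) ⊎ z ≡ nbr (fs (fs f0))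
      only ~z with nbr-only ~z
      ... | f0 , e = inj₁ e
      ... | fs f0 , e = inj₂ (inj₁ e)
      ... | fs (fs f0) , e = inj₂ (inj₂ e)

  node₀ : ∀ {y} → InS y → Node y
  node₀ {y} (e , y∈) with any? (λ k → y ≟ b k)
  ... | yes (k , refl) = inj₂ (Branch.branch k)
  ... | no ¬b with ∈-∃++ y∈
  ... | as , bs , eq with initLast as | bs
  -- A vertex that comes first or last on its path is a branch vertex.
  ... | [] | _ = contradiction (k4src e , just-injective (trans (sym (cong head eq)) (P-head e))) ¬b
  ... | as′ ∷ʳ′ p | [] = contradiction
        (k4tgt e , just-injective (trans (sym (trans (cong last eq) (last-snoc (as′ ∷ʳ p) y))) (P-last e))) ¬b
  ... | as′ ∷ʳ′ p | z ∷ bs′ = inj₁ (Interior.interior (λ k q → ¬b (k , q)) (e , true) as′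
        (trans eq (++-assoc as′ [ p ] _)))

  initial : State H
  initial = record
    { π = π
    ; lab = lab
    ; tl≢hd = lab-ends
    ; cons = λ α β → trans (proj₂ (unArc α)) (sym (proj₂ (unArc β)))
    ; seen = λ α → proj₁ (proj₁ (unArc α))
    ; full = full₀
    ; node = λ e → let (q , sx) = π-out e in subst Node q (node₀ sx)
    ; some = let (_ , sx , _) = proj₁ (unArc (Branch.nbr-arc f0 f0)) in _ , _ , π-in sx
    }
    where
    full₀ : ∀ {x y I J} → π x ≡ just I → π y ≡ just J → E H I J ≡ black → x ~ y
    full₀ ex ey e with π-out ex | π-out ey
    ... | refl , sx | refl , sy = (λ n → contradiction (trans (sym e) n) λ ()) , sx , sy

-- Monotonicity in `d` and the lower bound on twin-width.

ContrSeq-mono : ∀ {d d′ n} {G : Trigraph (suc n)} → d ≤ d′ → ContrSeq d G → ContrSeq d′ G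
ContrSeq-mono d≤ (done G r) = done G (λ i → ≤-trans (r i) d≤)
ContrSeq-mono d≤ (step G r u v u≢v σ) = step G (λ i → ≤-trans (r i) d≤) u v u≢v (ContrSeq-mono d≤ σ)

theorem6p6 : ∀ {n : ℕ} (H : Trigraph n) (K : InducedK4Subdivision (Adj H)) →
    GirthAtLeast 7 K → TwwAtLeast 3 H
theorem6p6 {zero} H K girth d _ with () ← InducedK4Subdivision.b K f0
theorem6p6 {suc n} H K girth d σ with 3 ≤? d
... | yes 3≤d = 3≤d
... | no 3≰d = ⊥-elim (Run.no-sequence Γ initial (ContrSeq-mono (≤-pred (≰⇒> 3≰d)) σ))
  where open Initial H K girth
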